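{- Let $q=4f+1$ be a prime, $\alpha$ a generator of $\mathbb Z_q^*$, and $D_k=\{\alpha^{4i+k}:i=0,1,\dots,f-1\}$ for $k=0,1,2,3$. Put $\mathfrak D_0=D_0\cup D_2$ and $\mathfrak D_1=D_1\cup D_3$, and let $\zeta_4\in\mathbb C$ be a primitive $4$th root of unity. Define the sequence $\underline a=(a_0,a_1,\dots,a_{q-1},\dots)$ of period $q$ by $a_i=\zeta_4^k$ if $i\in\mathfrak D_k$ ($k=0,1$) and $a_0=0$. Then $\underline a$ is an almost quaternary nearly perfect sequence of type $\frac{q-3}{2}$ with one zero-symbol, i.e. $C_{\underline a}(t)=\frac{q-3}{2}$ for all $1\le t\le q-1$.
   Context: $C_{\underline a}(t)=\sum_{i=0}^{q-1}a_i\overline{a_{i+t}}$, indices modulo $q$, bar denoting complex conjugation. -}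

module Defs where

open import Algebra.Bundles using (CommutativeMonoid)
open import Algebra.Bundles.Raw using (RawRing)
open import Data.Fin.Base using (Fin; toℕ)
open import Data.Fin.Patterns using (0F; 1F)
import Data.Fin.Subset as Subset
open import Data.Nat.Base as ℕ using (ℕ; NonZero)
open import Data.Nat.Coprimality using (Coprime)
open import Data.Nat.DivMod using (_%_; _mod_)
import Data.Nat.Properties as ℕ
open import Data.Product.Base using (_×_; _,_; ∃; ∃-syntax)
open import Data.Rational.Base as ℚ using (ℚ; 0ℚ; 1ℚ; ½)
import Data.Rational.Properties as ℚ
open import Level using (0ℓ)
open import Relation.Binary.PropositionalEquality
  using (_≡_; cong; cong₂; sym; trans; subst; module ≡-Reasoning)
open import Algebra.Properties.CommutativeSemigroup
  (CommutativeMonoid.commutativeSemigroup ℚ.+-0-commutativeMonoid)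
  using (interchange)
open import Algebra.Properties.Group ℚ.+-0-group using (//-rightDividesˡ)
open import Algebra.Properties.Ring ℚ.+-*-ring using (x[y-z]≈xy-xz; [y-z]x≈yx-zx)
open import Relation.Nullary using (¬_)
open import Relation.Unary using (Pred; _∈_; _∪_)

-- ℝ is Cauchy sequences of rationals with _≈ᵣ_ (difference is null) as equality.

IsCauchy : (ℕ → ℚ) → Set
IsCauchy u = ∀ ε → 0ℚ ℚ.< ε →
  ∃[ N ] (∀ m n → N ℕ.≤ m → N ℕ.≤ n → ℚ.∣ u m ℚ.- u n ∣ ℚ.< ε)

IsNull : (ℕ → ℚ) → Set
IsNull u = ∀ ε → 0ℚ ℚ.< ε → ∃[ N ] (∀ n → N ℕ.≤ n → ℚ.∣ u n ∣ ℚ.< ε)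

record ℝ : Set where
  constructor mkℝ
  field
    seq    : ℕ → ℚ
    cauchy : IsCauchy seq

open ℝ public

infix 4 _≈ᵣ_

record _≈ᵣ_ (x y : ℝ) : Set where
  constructor mk≈ᵣ
  field
    null : IsNull (λ n → seq x n ℚ.- seq y n)

private
  abstract

    split : ∀ p q → p ≡ (p ℚ.- q) ℚ.+ q
    split p q = sym (//-rightDividesˡ q p)

    +-rearrange : ∀ p q r s → (p ℚ.+ q) ℚ.- (r ℚ.+ s) ≡ (p ℚ.- r) ℚ.+ (q ℚ.- s)
    +-rearrange p q r s =
      trans (cong ((p ℚ.+ q) ℚ.+_) (ℚ.neg-distrib-+ r s))
            (interchange p q (ℚ.- r) (ℚ.- s))

    *-rearrange : ∀ p q r s →
      p ℚ.* q ℚ.- r ℚ.* s ≡ p ℚ.* (q ℚ.- s) ℚ.+ s ℚ.* (p ℚ.- r)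
    *-rearrange p q r s = begin
      p ℚ.* q ℚ.- r ℚ.* s
        ≡⟨ cong (ℚ._- r ℚ.* s) (split (p ℚ.* q) (p ℚ.* s)) ⟩
      (p ℚ.* q ℚ.- p ℚ.* s) ℚ.+ p ℚ.* s ℚ.- r ℚ.* s
        ≡⟨ ℚ.+-assoc (p ℚ.* q ℚ.- p ℚ.* s) (p ℚ.* s) (ℚ.- (r ℚ.* s)) ⟩
      (p ℚ.* q ℚ.- p ℚ.* s) ℚ.+ (p ℚ.* s ℚ.- r ℚ.* s)
        ≡⟨ cong₂ ℚ._+_ (x[y-z]≈xy-xz p q s) ([y-z]x≈yx-zx s p r) ⟨
      p ℚ.* (q ℚ.- s) ℚ.+ (p ℚ.- r) ℚ.* s
        ≡⟨ cong (p ℚ.* (q ℚ.- s) ℚ.+_) (ℚ.*-comm (p ℚ.- r) s) ⟩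
      p ℚ.* (q ℚ.- s) ℚ.+ s ℚ.* (p ℚ.- r) ∎
      where open ≡-Reasoning

    halve : ∀ ε → ½ ℚ.* ε ℚ.+ ½ ℚ.* ε ≡ ε
    halve ε = trans (sym (ℚ.*-distribʳ-+ ε ½ ½)) (ℚ.*-identityˡ ε)

    0<½*_ : ∀ {ε} → 0ℚ ℚ.< ε → 0ℚ ℚ.< ½ ℚ.* ε
    0<½*_ {ε} 0<ε = subst (ℚ._< ½ ℚ.* ε) (ℚ.*-zeroʳ ½) (ℚ.*-monoʳ-<-pos ½ 0<ε)

    const-cauchy : ∀ p → IsCauchy (λ _ → p)
    const-cauchy p ε 0<ε = 0 , λ _ _ _ _ →
      subst (ℚ._< ε) (sym (cong ℚ.∣_∣ (ℚ.+-inverseʳ p))) 0<ε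

    +-cauchy : ∀ u v → IsCauchy u → IsCauchy v → IsCauchy (λ n → u n ℚ.+ v n)
    +-cauchy u v cu cv ε 0<ε
      with M , hu ← cu (½ ℚ.* ε) (0<½* 0<ε)
         | N , hv ← cv (½ ℚ.* ε) (0<½* 0<ε)
      = M ℕ.⊔ N , λ m n le₁ le₂ → begin-strict
        ℚ.∣ (u m ℚ.+ v m) ℚ.- (u n ℚ.+ v n) ∣
          ≡⟨ cong ℚ.∣_∣ (+-rearrange (u m) (v m) (u n) (v n)) ⟩
        ℚ.∣ (u m ℚ.- u n) ℚ.+ (v m ℚ.- v n) ∣
          ≤⟨ ℚ.∣p+q∣≤∣p∣+∣q∣ (u m ℚ.- u n) (v m ℚ.- v n) ⟩
        ℚ.∣ u m ℚ.- u n ∣ ℚ.+ ℚ.∣ v m ℚ.- v n ∣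
          <⟨ ℚ.+-mono-< (hu m n (ℕ.m⊔n≤o⇒m≤o M N le₁) (ℕ.m⊔n≤o⇒m≤o M N le₂))
                        (hv m n (ℕ.m⊔n≤o⇒n≤o M N le₁) (ℕ.m⊔n≤o⇒n≤o M N le₂)) ⟩
        ½ ℚ.* ε ℚ.+ ½ ℚ.* ε
          ≡⟨ halve ε ⟩
        ε ∎
      where
      open ℚ.≤-Reasoning

    neg-cauchy : ∀ u → IsCauchy u → IsCauchy (λ n → ℚ.- u n)
    neg-cauchy u cu ε 0<ε with N , hu ← cu ε 0<ε = N , λ m n le₁ le₂ →
      subst (ℚ._< ε)
        (trans (sym (ℚ.∣-p∣≡∣p∣ (u m ℚ.- u n)))
               (cong ℚ.∣_∣ (ℚ.neg-distrib-+ (u m) (ℚ.- u n))))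
        (hu m n le₁ le₂)

    bounded : ∀ {u} → IsCauchy u →
      ∃[ K ] (ℚ.Positive K × ∃[ N ] (∀ n → N ℕ.≤ n → ℚ.∣ u n ∣ ℚ.≤ K))
    bounded {u} cu with N , hu ← cu 1ℚ (ℚ.positive⁻¹ 1ℚ) =
      1ℚ ℚ.+ ℚ.∣ u N ∣ ,
      ℚ.pos+nonNeg⇒pos 1ℚ ℚ.∣ u N ∣ ⦃ ℚ.∣-∣-nonNeg (u N) ⦄ ,
      N , λ n le → begin
        ℚ.∣ u n ∣                        ≡⟨ cong ℚ.∣_∣ (split (u n) (u N)) ⟩
        ℚ.∣ (u n ℚ.- u N) ℚ.+ u N ∣      ≤⟨ ℚ.∣p+q∣≤∣p∣+∣q∣ (u n ℚ.- u N) (u N) ⟩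
        ℚ.∣ u n ℚ.- u N ∣ ℚ.+ ℚ.∣ u N ∣  ≤⟨ ℚ.+-monoˡ-≤ ℚ.∣ u N ∣ (ℚ.<⇒≤ (hu n N le ℕ.≤-refl)) ⟩
        1ℚ ℚ.+ ℚ.∣ u N ∣                 ∎
      where
      open ℚ.≤-Reasoning

    shrink : ∀ K → ℚ.Positive K → ∀ ε → 0ℚ ℚ.< ε →
      ∃[ δ ] (0ℚ ℚ.< δ × (∀ p d → ℚ.∣ p ∣ ℚ.≤ K → ℚ.∣ d ∣ ℚ.< δ → ℚ.∣ p ℚ.* d ∣ ℚ.< ½ ℚ.* ε))
    shrink K pos ε 0<ε = δ , 0<δ , λ p d p≤K d<δ → begin-strict
        ℚ.∣ p ℚ.* d ∣        ≡⟨ ℚ.∣p*q∣≡∣p∣*∣q∣ p d ⟩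
        ℚ.∣ p ∣ ℚ.* ℚ.∣ d ∣  ≤⟨ ℚ.*-monoʳ-≤-nonNeg ℚ.∣ d ∣ ⦃ ℚ.∣-∣-nonNeg d ⦄ p≤K ⟩
        K ℚ.* ℚ.∣ d ∣        <⟨ ℚ.*-monoʳ-<-pos K d<δ ⟩
        K ℚ.* δ              ≡⟨ sym (ℚ.*-assoc K (ℚ.1/ K) (½ ℚ.* ε)) ⟩
        (K ℚ.* ℚ.1/ K) ℚ.* (½ ℚ.* ε) ≡⟨ cong (ℚ._* (½ ℚ.* ε)) (ℚ.*-inverseʳ K) ⟩
        1ℚ ℚ.* (½ ℚ.* ε)     ≡⟨ ℚ.*-identityˡ (½ ℚ.* ε) ⟩
        ½ ℚ.* ε              ∎
      where
      open ℚ.≤-Reasoning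
      instance
        K-pos : ℚ.Positive K
        K-pos = pos
        K-nonZero : ℚ.NonZero K
        K-nonZero = ℚ.pos⇒nonZero K
        1/K-pos : ℚ.Positive (ℚ.1/ K)
        1/K-pos = ℚ.1/pos⇒pos K
      δ : ℚ
      δ = ℚ.1/ K ℚ.* (½ ℚ.* ε)
      0<δ : 0ℚ ℚ.< δ
      0<δ = subst (ℚ._< δ) (ℚ.*-zeroʳ (ℚ.1/ K)) (ℚ.*-monoʳ-<-pos (ℚ.1/ K) (0<½* 0<ε))

    *-cauchy : ∀ u v → IsCauchy u → IsCauchy v → IsCauchy (λ n → u n ℚ.* v n)
    *-cauchy u v cu cv ε 0<ε =
      let K , K>0 , A , hK = bounded cu
          L , L>0 , B , hL = bounded cv
          δ , 0<δ , hδ = shrink K K>0 ε 0<ε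
          η , 0<η , hη = shrink L L>0 ε 0<ε
          M , hv = cv δ 0<δ
          N , hu = cu η 0<η
      in (A ℕ.⊔ B) ℕ.⊔ (M ℕ.⊔ N) , λ m n le₁ le₂ →
        let A≤m  = ℕ.m⊔n≤o⇒m≤o A B (ℕ.m⊔n≤o⇒m≤o (A ℕ.⊔ B) (M ℕ.⊔ N) le₁)
            B≤n  = ℕ.m⊔n≤o⇒n≤o A B (ℕ.m⊔n≤o⇒m≤o (A ℕ.⊔ B) (M ℕ.⊔ N) le₂)
            MN≤m = ℕ.m⊔n≤o⇒n≤o (A ℕ.⊔ B) (M ℕ.⊔ N) le₁
            MN≤n = ℕ.m⊔n≤o⇒n≤o (A ℕ.⊔ B) (M ℕ.⊔ N) le₂
        in estimate m n
             (hδ (u m) (v m ℚ.- v n) (hK m A≤m)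
               (hv m n (ℕ.m⊔n≤o⇒m≤o M N MN≤m) (ℕ.m⊔n≤o⇒m≤o M N MN≤n)))
             (hη (v n) (u m ℚ.- u n) (hL n B≤n)
               (hu m n (ℕ.m⊔n≤o⇒n≤o M N MN≤m) (ℕ.m⊔n≤o⇒n≤o M N MN≤n)))
      where
      open ℚ.≤-Reasoning
      estimate : ∀ m n →
        ℚ.∣ u m ℚ.* (v m ℚ.- v n) ∣ ℚ.< ½ ℚ.* ε →
        ℚ.∣ v n ℚ.* (u m ℚ.- u n) ∣ ℚ.< ½ ℚ.* ε →
        ℚ.∣ u m ℚ.* v m ℚ.- u n ℚ.* v n ∣ ℚ.< ε
      estimate m n h₁ h₂ = begin-strict
        ℚ.∣ u m ℚ.* v m ℚ.- u n ℚ.* v n ∣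
          ≡⟨ cong ℚ.∣_∣ (*-rearrange (u m) (v m) (u n) (v n)) ⟩
        ℚ.∣ u m ℚ.* (v m ℚ.- v n) ℚ.+ v n ℚ.* (u m ℚ.- u n) ∣
          ≤⟨ ℚ.∣p+q∣≤∣p∣+∣q∣ (u m ℚ.* (v m ℚ.- v n)) (v n ℚ.* (u m ℚ.- u n)) ⟩
        ℚ.∣ u m ℚ.* (v m ℚ.- v n) ∣ ℚ.+ ℚ.∣ v n ℚ.* (u m ℚ.- u n) ∣
          <⟨ ℚ.+-mono-< h₁ h₂ ⟩
        ½ ℚ.* ε ℚ.+ ½ ℚ.* ε
          ≡⟨ halve ε ⟩
        ε ∎

infixl 6 _+ᵣ_ _-ᵣ_
infixl 7 _*ᵣ_
infix  8 -ᵣ_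

fromℚᵣ : ℚ → ℝ
fromℚᵣ p = mkℝ (λ _ → p) (const-cauchy p)

_+ᵣ_ : ℝ → ℝ → ℝ
x +ᵣ y = mkℝ (λ n → seq x n ℚ.+ seq y n) (+-cauchy (seq x) (seq y) (cauchy x) (cauchy y))

-ᵣ_ : ℝ → ℝ
-ᵣ x = mkℝ (λ n → ℚ.- seq x n) (neg-cauchy (seq x) (cauchy x))

_-ᵣ_ : ℝ → ℝ → ℝ
x -ᵣ y = x +ᵣ (-ᵣ y)

_*ᵣ_ : ℝ → ℝ → ℝ
x *ᵣ y = mkℝ (λ n → seq x n ℚ.* seq y n) (*-cauchy (seq x) (seq y) (cauchy x) (cauchy y))

infix 5 _+i_

record ℂ : Set where
  constructor _+i_
  field
    re : ℝ
    im : ℝ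

open ℂ public

infix 4 _≈_

record _≈_ (z w : ℂ) : Set where
  constructor mk≈
  field
    re≈ : re z ≈ᵣ re w
    im≈ : im z ≈ᵣ im w

fromℚ : ℚ → ℂ
fromℚ p = fromℚᵣ p +i fromℚᵣ 0ℚ

conj : ℂ → ℂ
conj z = re z +i (-ᵣ im z)

ℂ-rawRing : RawRing 0ℓ 0ℓ
ℂ-rawRing = record
  { Carrier = ℂ
  ; _≈_     = _≈_
  ; _+_     = λ z w → (re z +ᵣ re w) +i (im z +ᵣ im w)
  ; _*_     = λ z w → (re z *ᵣ re w -ᵣ im z *ᵣ im w) +i (re z *ᵣ im w +ᵣ im z *ᵣ re w)
  ; -_      = λ z → (-ᵣ re z) +i (-ᵣ im z)
  ; 0#      = fromℚ 0ℚ
  ; 1#      = fromℚ 1ℚ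
  }

open RawRing ℂ-rawRing public
  using (_+_; _*_; -_; 0#; 1#)
open import Algebra.Definitions.RawSemiring (RawRing.rawSemiring ℂ-rawRing) public
  using (_^_; sum)

IsPrimitiveRoot : ℕ → ℂ → Set
IsPrimitiveRoot m ζ =
  (ζ ^ m ≈ 1#) × (∀ d → 1 ℕ.≤ d → d ℕ.< m → ¬ (ζ ^ d ≈ 1#))

HasPeriod : ℕ → (ℕ → ℂ) → Set
HasPeriod n a = ∀ i → a (i ℕ.+ n) ≈ a i

autocorrelation : (n : ℕ) .⦃ _ : NonZero n ⦄ → (ℕ → ℂ) → ℕ → ℂ
autocorrelation n a t =
  sum {n} λ i → a (toℕ i) * conj (a ((toℕ i ℕ.+ t) % n))

-- Exactly s entries of a period are zero symbols; every other entry is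
-- ζ ^ b for some 0 ≤ b < m.
IsAlmostMAry : (m s n : ℕ) → ℂ → (ℕ → ℂ) → Set
IsAlmostMAry m s n ζ a = ∃[ Z ] (Subset.∣ Z ∣ ≡ s)
  × (∀ (i : Fin n) → i Subset.∈ Z → a (toℕ i) ≈ 0#)
  × (∀ (i : Fin n) → i Subset.∉ Z → ∃[ b ] a (toℕ i) ≈ ζ ^ toℕ {m} b)

record IsAlmostMAryNPS (m s n : ℕ) .⦃ _ : NonZero n ⦄
                       (ζ γ : ℂ) (a : ℕ → ℂ) : Set where
  field
    primitiveRoot : IsPrimitiveRoot m ζ
    period        : HasPeriod n a
    almostMAry    : IsAlmostMAry m s n ζ a
    nearlyPerfect : ∀ t → 1 ℕ.≤ t → t ℕ.≤ n ℕ.∸ 1 → autocorrelation n a t ≈ γ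

-- Fin q represents ℤ_q; its units are the residues coprime to q.

powMod : (q : ℕ) .⦃ _ : NonZero q ⦄ → Fin q → ℕ → Fin q
powMod q α e = (toℕ α ℕ.^ e) mod q

IsGenerator : (q : ℕ) .⦃ _ : NonZero q ⦄ → Fin q → Set
IsGenerator q α = Coprime (toℕ α) q
  × (∀ x → Coprime (toℕ x) q → ∃[ e ] x ≡ powMod q α e)

module _ (q f : ℕ) .⦃ _ : NonZero q ⦄ (α : Fin q) where

  D : ℕ → Pred (Fin q) 0ℓ
  D k x = ∃ λ (i : Fin f) → x ≡ powMod q α (4 ℕ.* toℕ i ℕ.+ k)

  𝔇 : Fin 2 → Pred (Fin q) 0ℓ
  𝔇 0F = D 0 ∪ D 2
  𝔇 1F = D 1 ∪ D 3

  record IsCyclotomicSequence (ζ : ℂ) (a : ℕ → ℂ) : Set where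
    field
      period  : HasPeriod q a
      atZero  : a 0 ≈ 0#
      onClass : ∀ (k : Fin 2) (i : Fin q) → i ∈ 𝔇 k → a (toℕ i) ≈ ζ ^ toℕ k

-- A primitive fourth root of unity ζ is purely imaginary of modulus 1, so
-- ζ ≈ iy with y² ≈ 1, and a ≈ u + iyw, where u and w are the indicators of the
-- even and odd powers of α. Hence C(t) has real part ∑ uu′ + ww′ and imaginary
-- part y ∑ wu′ − uw′, the prime denoting a shift by t. The latter sum changes
-- sign under i ↦ −(i + t), because −1 is an even power of α. With the
-- quadratic character χ = u − w and ε = u + w, the former is half of
-- ∑ εε′ + ∑ χχ′ = (q − 2) − 1, where ∑ χχ′ = −1 because χ(i)χ(i + t) =
-- χ(1 + t i⁻¹) for i ≠ 0 and 1 + t i⁻¹ runs through everything but 1.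
-- On Cauchy reals, xy ≈ 0 and y ≉ 0 give x ≈ 0, which is what determines ζ
-- from the negative information in the definition of a primitive root.

module Submission where

open import Data.Fin.Base using (Fin; zero; suc; toℕ; fromℕ<; punchOut)
open import Data.Fin.Patterns using (0F; 1F)
open import Data.Fin.Permutation using (permutation)
open import Data.Fin.Properties
  using (toℕ-injective; toℕ-fromℕ<; toℕ<n; injective⇒≤; pigeonhole; punchOut-injective)
  renaming (suc-injective to Fin-suc-injective)
import Data.Fin.Subset as Subset
import Data.Fin.Subset.Properties as Subset
open import Data.Integer.Base as ℤ using ()
import Data.Integer.Tactic.RingSolver as ℤ
open import Data.Nat.Base as ℕ using (ℕ; zero; suc; NonZero; z≤n; s≤s)
open import Data.Nat.Coprimality using (Coprime; coprime-Bézout; prime⇒coprime)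
open import Data.Nat.Divisibility using (_∣_; divides; m%n≡0⇒n∣m)
open import Data.Nat.DivMod
open import Data.Nat.GCD using (module Bézout)
open import Data.Nat.Primality using (Prime; ¬prime[1])
import Data.Nat.Properties as ℕ
open import Data.Nat.Tactic.RingSolver using (solve-∀)
open import Data.Product.Base using (_×_; _,_; ∃-syntax; proj₁; proj₂)
open import Data.Rational.Base as ℚ using (ℚ; 0ℚ; 1ℚ; ½)
import Data.Rational.Properties as ℚ
open import Algebra.Properties.CommutativeMonoid.Sum ℚ.+-0-commutativeMonoid as ℚΣ using ()
open import Data.Rational.Solver using (module +-*-Solver)
open import Data.Rational.Unnormalised.Base as ℚᵘ using (mkℚᵘ; *≡*)
import Data.Rational.Unnormalised.Properties as ℚᵘ
open import Data.Sum.Base using (inj₁; inj₂)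
open import Function.Base using (_∘_)
open import Relation.Binary.Bundles using (Setoid)
open import Relation.Binary.PropositionalEquality hiding (setoid)
import Relation.Binary.Reasoning.Setoid as SetoidReasoning
open import Relation.Nullary using (¬_; Dec; yes; no; contradiction)
open import Relation.Nullary.Decidable using (map′)
open import Relation.Unary using (_∈_)

open +-*-Solver using (solve; con; _:+_; _:*_; _:-_; :-_; _:=_)

open import Defs using (powMod; IsGenerator)

-- Congruence modulo `q` and sums over all residues.

module Congruence (q : ℕ) .⦃ _ : NonZero q ⦄ where

  open import Data.Nat.Base using (_+_; _*_; _^_)

  infix 4 _∼_ _∼?_

  -- Wrapping the equation of remainders in a record lets `i` and `j` be inferred from the type of a
  -- proof.
  record _∼_ (i j : ℕ) : Set where
    constructor mk∼
    field
      residues : i % q ≡ j % q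

  open _∼_ public

  _∼?_ : ∀ i j → Dec (i ∼ j)
  i ∼? j = map′ mk∼ residues (i % q ℕ.≟ j % q)

  ∼-setoid : Setoid _ _
  ∼-setoid = record
    { Carrier = ℕ
    ; _≈_ = _∼_
    ; isEquivalence = record
      { refl = mk∼ refl
      ; sym = λ i∼j → mk∼ (sym (residues i∼j))
      ; trans = λ i∼j j∼k → mk∼ (trans (residues i∼j) (residues j∼k))
      }
    }

  open Setoid ∼-setoid public
    using () renaming (refl to ∼-refl; sym to ∼-sym; trans to ∼-trans; reflexive to ∼-reflexive)

  %-∼ : ∀ i → i % q ∼ i
  %-∼ i = mk∼ (m%n%n≡m%n i q)

  ∼⇒≡ : ∀ {i j} → i ℕ.< q → j ℕ.< q → i ∼ j → i ≡ j
  ∼⇒≡ i<q j<q (mk∼ eq) = trans (sym (m<n⇒m%n≡m i<q)) (trans eq (m<n⇒m%n≡m j<q))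

  +-cong : ∀ {i i′ j j′} → i ∼ i′ → j ∼ j′ → i + j ∼ i′ + j′
  +-cong {i} {i′} {j} {j′} (mk∼ p) (mk∼ r) = mk∼ (begin
    (i + j) % q              ≡⟨ %-distribˡ-+ i j q ⟩
    (i % q + j % q) % q      ≡⟨ cong₂ (λ a b → (a + b) % q) p r ⟩
    (i′ % q + j′ % q) % q    ≡⟨ %-distribˡ-+ i′ j′ q ⟨
    (i′ + j′) % q            ∎)
    where open ≡-Reasoning

  *-cong : ∀ {i i′ j j′} → i ∼ i′ → j ∼ j′ → i * j ∼ i′ * j′
  *-cong {i} {i′} {j} {j′} (mk∼ p) (mk∼ r) = mk∼ (begin
    (i * j) % q              ≡⟨ %-distribˡ-* i j q ⟩
    ((i % q) * (j % q)) % q  ≡⟨ cong₂ (λ a b → (a * b) % q) p r ⟩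
    ((i′ % q) * (j′ % q)) % q ≡⟨ %-distribˡ-* i′ j′ q ⟨
    (i′ * j′) % q            ∎)
    where open ≡-Reasoning

  *-congˡ : ∀ k {i j} → i ∼ j → k * i ∼ k * j
  *-congˡ k = *-cong (∼-refl {k})

  *-congʳ : ∀ k {i j} → i ∼ j → i * k ∼ j * k
  *-congʳ k i∼j = *-cong i∼j (∼-refl {k})

  ^-congˡ : ∀ {i j} e → i ∼ j → i ^ e ∼ j ^ e
  ^-congˡ zero    i∼j = ∼-refl
  ^-congˡ (suc e) i∼j = *-cong i∼j (^-congˡ e i∼j)

  +-multiple : ∀ i k → i + k * q ∼ i
  +-multiple i k = mk∼ ([m+kn]%n≡m%n i k q)

  ∑ : (ℕ → ℚ) → ℚ
  ∑ F = ℚΣ.sum {q} (F ∘ toℕ)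

  ∑-cong : ∀ {F G} → (∀ i → F i ≡ G i) → ∑ F ≡ ∑ G
  ∑-cong F≗G = ℚΣ.sum-cong-≗ {q} (F≗G ∘ toℕ)

  ∑-+ : ∀ F G → ∑ (λ i → F i ℚ.+ G i) ≡ ∑ F ℚ.+ ∑ G
  ∑-+ F G = ℚΣ.∑-distrib-+ {q} (F ∘ toℕ) (G ∘ toℕ)

  -- `φ` and `ψ` act on naturals and are mutually inverse only modulo `q`; reducing their values
  -- gives a permutation of `Fin q`.
  ∑-reindex : ∀ (F : ℕ → ℚ) → (∀ {i j} → i ∼ j → F i ≡ F j) →
    (φ ψ : ℕ → ℕ) → (∀ {i j} → i ∼ j → φ i ∼ φ j) → (∀ {i j} → i ∼ j → ψ i ∼ ψ j) →
    (∀ i → φ (ψ i) ∼ i) → (∀ i → ψ (φ i) ∼ i) →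
    ∑ (F ∘ φ) ≡ ∑ F
  ∑-reindex F F-cong φ ψ φ-cong ψ-cong φψ ψφ = sym (trans
    (ℚΣ.sum-permute {q} {q} (F ∘ toℕ) (permutation (lift φ) (lift ψ) (inverse φ ψ φ-cong φψ) (inverse ψ φ ψ-cong ψφ)))
    (ℚΣ.sum-cong-≗ {q} λ i → F-cong (toℕ-lift φ i)))
    where
    lift : (ℕ → ℕ) → Fin q → Fin q
    lift θ i = θ (toℕ i) mod q
    toℕ-lift : ∀ θ i → toℕ (lift θ i) ∼ θ (toℕ i)
    toℕ-lift θ i = ∼-trans (∼-reflexive (toℕ-fromℕ< (m%n<n (θ (toℕ i)) q))) (%-∼ (θ (toℕ i)))
    inverse : ∀ θ η → (∀ {i j} → i ∼ j → θ i ∼ θ j) → (∀ i → θ (η i) ∼ i) → ∀ i → lift θ (lift η i) ≡ i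
    inverse θ η θ-cong θη i = toℕ-injective (∼⇒≡ (toℕ<n _) (toℕ<n i)
      (∼-trans (toℕ-lift θ (lift η i)) (∼-trans (θ-cong (toℕ-lift η i)) (θη (toℕ i)))))

-- The sign (-1)^e of an exponent.

sign : ℕ → ℚ
sign zero    = 1ℚ
sign (suc e) = ℚ.- sign e

sign-+ : ∀ d e → sign (d ℕ.+ e) ≡ sign d ℚ.* sign e
sign-+ zero    e = sym (ℚ.*-identityˡ (sign e))
sign-+ (suc d) e = trans (cong ℚ.-_ (sign-+ d e)) (ℚ.neg-distribˡ-* (sign d) (sign e))

sign-double : ∀ e → sign (e ℕ.+ e) ≡ 1ℚ
sign-double zero    = refl
sign-double (suc e) = begin
  ℚ.- sign (e ℕ.+ suc e)  ≡⟨ cong (ℚ.-_ ∘ sign) (ℕ.+-suc e e) ⟩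
  ℚ.- ℚ.- sign (e ℕ.+ e)  ≡⟨ solve 1 (λ s → :- :- s := s) refl (sign (e ℕ.+ e)) ⟩
  sign (e ℕ.+ e)          ≡⟨ sign-double e ⟩
  1ℚ                      ∎
  where open ≡-Reasoning

*-cancel-inverse : ∀ {a b c} → a ℚ.* c ≡ 1ℚ → b ℚ.* c ≡ 1ℚ → a ≡ b
*-cancel-inverse {a} {b} {c} ac≡1 bc≡1 = begin
  a                ≡⟨ ℚ.*-identityʳ a ⟨
  a ℚ.* 1ℚ         ≡⟨ cong (a ℚ.*_) bc≡1 ⟨
  a ℚ.* (b ℚ.* c)  ≡⟨ solve 3 (λ a b c → a :* (b :* c) := b :* (a :* c)) refl a b c ⟩
  b ℚ.* (a ℚ.* c)  ≡⟨ cong (b ℚ.*_) ac≡1 ⟩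
  b ℚ.* 1ℚ         ≡⟨ ℚ.*-identityʳ b ⟩
  b                ∎
  where open ≡-Reasoning

double-injective : ∀ {d e} → d ℕ.+ d ≡ e ℕ.+ e → d ≡ e
double-injective {d} {e} eq = ℕ.*-cancelʳ-≡ d e 2 (trans (twice d) (trans eq (sym (twice e))))
  where
  twice : ∀ k → k ℕ.* 2 ≡ k ℕ.+ k
  twice = solve-∀

-- The order of the generator and the parity of discrete logarithms.

module QuadraticCharacter
  (f r : ℕ) (n≡4f : suc r ≡ 4 ℕ.* f) (q-prime : Prime (suc (suc r)))
  (g : Fin (suc (suc r))) (generator : IsGenerator (suc (suc r)) g) where

  open import Data.Nat.Base using (_+_; _*_; _^_; _∸_; _≤_; _<_)

  n q α : ℕ
  n = suc r
  q = suc n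
  α = toℕ g

  open Congruence q public
  open SetoidReasoning ∼-setoid

  1≁0 : ¬ (1 ∼ 0)
  1≁0 (mk∼ ())

  -- The remainder of `x` is nonzero and below the prime `q`, hence coprime to it, so the generator
  -- reaches it.
  log : ∀ x → ¬ (x ∼ 0) → ∃[ e ] x ∼ α ^ e
  log x x≁0 with generator .proj₂ (x mod q) (coprime (x % q) (m%n<n x q) (λ eq → x≁0 (mk∼ eq)))
    where
    coprime : ∀ y (y<q : y < q) → y ≢ 0 → Coprime (toℕ (fromℕ< y<q)) q
    coprime zero    y<q y≢0 = contradiction refl y≢0
    coprime (suc y) y<q y≢0 rewrite toℕ-fromℕ< y<q = λ (d∣y , d∣q) → prime⇒coprime q-prime y<q (d∣q , d∣y)
  ... | e , eq = e , mk∼ (trans (sym (toℕ-fromℕ< (m%n<n x q)))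
    (trans (cong toℕ eq) (toℕ-fromℕ< (m%n<n (α ^ e) q))))

  α-inverse : ∃[ β ] β * α ∼ 1
  α-inverse with coprime-Bézout (generator .proj₁)
  ... | Bézout.+- x y eq = x , (begin
    x * α      ≡⟨ eq ⟨
    1 + y * q  ≈⟨ +-multiple 1 y ⟩
    1          ∎)
  -- Here 1 + xα = yq, so the inverse is -x; `n` = q - 1 serves as -1.
  ... | Bézout.-+ x y eq = n * x , (begin
    n * x * α                    ≈⟨ +-multiple (n * x * α) 1 ⟨
    n * x * α + 1 * suc n        ≡⟨ rearrange n x α ⟩
    1 + n * (1 + x * α)          ≡⟨ cong (λ k → 1 + n * k) eq ⟩
    1 + n * (y * q)              ≡⟨ cong (1 +_) (ℕ.*-assoc n y q) ⟨
    1 + n * y * q                ≈⟨ +-multiple 1 (n * y) ⟩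
    1                            ∎)
    where
    rearrange : ∀ n x a → n * x * a + 1 * suc n ≡ 1 + n * (1 + x * a)
    rearrange = solve-∀

  β : ℕ
  β = α-inverse .proj₁

  β^*α^ : ∀ e → β ^ e * α ^ e ∼ 1
  β^*α^ zero    = ∼-refl
  β^*α^ (suc e) = begin
    β * β ^ e * (α * α ^ e)    ≡⟨ swap β (β ^ e) α (α ^ e) ⟩
    β * α * (β ^ e * α ^ e)    ≈⟨ *-cong (α-inverse .proj₂) (β^*α^ e) ⟩
    1                          ∎
    where
    swap : ∀ a b c d → a * b * (c * d) ≡ a * c * (b * d)
    swap = solve-∀

  α^≁0 : ∀ e → ¬ (α ^ e ∼ 0)
  α^≁0 e α^e∼0 = 1≁0 (begin
    1              ≈⟨ β^*α^ e ⟨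
    β ^ e * α ^ e  ≈⟨ *-congˡ (β ^ e) α^e∼0 ⟩
    β ^ e * 0      ≡⟨ ℕ.*-zeroʳ (β ^ e) ⟩
    0              ∎)

  1^ : ∀ {x} e → x ∼ 1 → x ^ e ∼ 1
  1^ e x∼1 = ∼-trans (^-congˡ e x∼1) (∼-reflexive (ℕ.^-zeroˡ e))

  α^-% : ∀ d .⦃ _ : NonZero d ⦄ → α ^ d ∼ 1 → ∀ e → α ^ e ∼ α ^ (e % d)
  α^-% d α^d∼1 e = begin
    α ^ e                              ≡⟨ cong (α ^_) (m≡m%n+[m/n]*n e d) ⟩
    α ^ (e % d + e / d * d)            ≡⟨ ℕ.^-distribˡ-+-* α (e % d) (e / d * d) ⟩
    α ^ (e % d) * α ^ (e / d * d)      ≡⟨ cong (λ k → α ^ (e % d) * α ^ k) (ℕ.*-comm (e / d) d) ⟩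
    α ^ (e % d) * α ^ (d * (e / d))    ≡⟨ cong (α ^ (e % d) *_) (ℕ.^-*-assoc α d (e / d)) ⟨
    α ^ (e % d) * (α ^ d) ^ (e / d)    ≈⟨ *-congˡ (α ^ (e % d)) (1^ (e / d) α^d∼1) ⟩
    α ^ (e % d) * 1                    ≡⟨ ℕ.*-identityʳ (α ^ (e % d)) ⟩
    α ^ (e % d)                        ∎

  -- The logarithm modulo the order embeds the units into Fin (suc d).
  order-≥ : ∀ d → α ^ suc d ∼ 1 → n ≤ suc d
  order-≥ d α^d∼1 = injective⇒≤ {f = logMod} λ {i} {j} eq →
    Fin-suc-injective (toℕ-injective (∼⇒≡ (toℕ<n (suc i)) (toℕ<n (suc j)) (begin
      toℕ (suc i)              ≈⟨ exponent i .proj₂ ⟩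
      α ^ exponent i .proj₁    ≈⟨ α^-% (suc d) α^d∼1 (exponent i .proj₁) ⟩
      α ^ (exponent i .proj₁ % suc d) ≡⟨ cong (α ^_) (trans (sym (toℕ-logMod i)) (trans (cong toℕ eq) (toℕ-logMod j))) ⟩
      α ^ (exponent j .proj₁ % suc d) ≈⟨ α^-% (suc d) α^d∼1 (exponent j .proj₁) ⟨
      α ^ exponent j .proj₁    ≈⟨ exponent j .proj₂ ⟨
      toℕ (suc j)              ∎)))
    where
    exponent : ∀ (i : Fin n) → ∃[ e ] toℕ (suc i) ∼ α ^ e
    exponent i = log (toℕ (suc i)) λ i∼0 → contradiction (∼⇒≡ (toℕ<n (suc i)) (s≤s z≤n) i∼0) λ ()
    logMod : Fin n → Fin (suc d)
    logMod i = exponent i .proj₁ mod suc d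
    toℕ-logMod : ∀ i → toℕ (logMod i) ≡ exponent i .proj₁ % suc d
    toℕ-logMod i = toℕ-fromℕ< (m%n<n (exponent i .proj₁) (suc d))

  -- Cancelling α^i gives α^(j - i) ∼ 1 with 0 < j - i ≤ `n`, while `order-≥` gives `n` ≤ j - i.
  -- Hence j - i is `n`.
  α^i∼α^j⇒α^n∼1 : ∀ {i j} → i < j → j ≤ n → α ^ i ∼ α ^ j → α ^ n ∼ 1
  α^i∼α^j⇒α^n∼1 {i} {j} i<j j≤n α^i∼α^j = go (j ∸ i) refl
    where
    α^[j-i]∼1 : α ^ (j ∸ i) ∼ 1
    α^[j-i]∼1 = begin
      α ^ (j ∸ i)                    ≡⟨ ℕ.*-identityˡ (α ^ (j ∸ i)) ⟨
      1 * α ^ (j ∸ i)                ≈⟨ *-congʳ (α ^ (j ∸ i)) (β^*α^ i) ⟨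
      β ^ i * α ^ i * α ^ (j ∸ i)    ≡⟨ ℕ.*-assoc (β ^ i) (α ^ i) (α ^ (j ∸ i)) ⟩
      β ^ i * (α ^ i * α ^ (j ∸ i))  ≡⟨ cong (β ^ i *_) (ℕ.^-distribˡ-+-* α i (j ∸ i)) ⟨
      β ^ i * α ^ (i + (j ∸ i))      ≡⟨ cong (λ k → β ^ i * α ^ k) (ℕ.m+[n∸m]≡n (ℕ.<⇒≤ i<j)) ⟩
      β ^ i * α ^ j                  ≈⟨ *-congˡ (β ^ i) α^i∼α^j ⟨
      β ^ i * α ^ i                  ≈⟨ β^*α^ i ⟩
      1                              ∎
    go : ∀ d → j ∸ i ≡ d → α ^ n ∼ 1
    go zero    eq = contradiction (ℕ.m∸n≡0⇒m≤n eq) (ℕ.<⇒≱ i<j)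
    go (suc d) eq = subst (λ k → α ^ k ∼ 1) (sym (ℕ.≤-antisym (order-≥ d α^d∼1) d<n)) α^d∼1
      where
      α^d∼1 : α ^ suc d ∼ 1
      α^d∼1 = subst (λ k → α ^ k ∼ 1) eq α^[j-i]∼1
      d<n : suc d ≤ n
      d<n = subst (_≤ n) eq (ℕ.≤-trans (ℕ.m∸n≤m j i) j≤n)

  -- The `q` powers with exponents 0 to `n` avoid the residue 0, which `punchOut` removes. They fall
  -- into `n` classes, so two of them coincide.
  α^n∼1 : α ^ n ∼ 1
  α^n∼1 =
    let i , j , i<j , eq = pigeonhole (ℕ.n<1+n n) index
    in α^i∼α^j⇒α^n∼1 i<j (ℕ.≤-pred (toℕ<n j)) (index-injective i j eq)
    where
    residue : ℕ → Fin q
    residue e = (α ^ e) mod q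
    toℕ-residue : ∀ e → toℕ (residue e) ≡ α ^ e % q
    toℕ-residue e = toℕ-fromℕ< (m%n<n (α ^ e) q)
    nonzero : ∀ e → zero ≢ residue e
    nonzero e eq = α^≁0 e (mk∼ (trans (sym (toℕ-residue e)) (cong toℕ (sym eq))))
    index : Fin q → Fin n
    index e = punchOut (nonzero (toℕ e))
    index-injective : ∀ i j → index i ≡ index j → α ^ toℕ i ∼ α ^ toℕ j
    index-injective i j eq = mk∼ (trans (sym (toℕ-residue (toℕ i)))
      (trans (cong toℕ (punchOut-injective (nonzero (toℕ i)) (nonzero (toℕ j)) eq))
        (toℕ-residue (toℕ j))))

  -- The remainder of `e` modulo `n` is again an exponent giving 1. Being less than `n`, it cannot
  -- be positive by `order-≥`.
  n∣exponent : ∀ e → α ^ e ∼ 1 → n ∣ e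
  n∣exponent e α^e∼1 = m%n≡0⇒n∣m e n (remainder (e % n) refl)
    where
    remainder : ∀ d → e % n ≡ d → e % n ≡ 0
    remainder zero    eq = eq
    remainder (suc d) eq = contradiction (subst (_< n) eq (m%n<n e n)) (ℕ.≤⇒≯ (order-≥ d
      (subst (λ k → α ^ k ∼ 1) eq (∼-trans (∼-sym (α^-% n α^n∼1 e)) α^e∼1))))

  -- The outer doubling makes `n` even. The inner one makes n/2 even, which is what makes -1 an even
  -- power of `α`.
  n≡h+h : n ≡ (f + f) + (f + f)
  n≡h+h = trans n≡4f (quadruple f)
    where
    quadruple : ∀ f → 4 * f ≡ (f + f) + (f + f)
    quadruple = solve-∀

  sign-multiple : ∀ {e} → n ∣ e → sign e ≡ 1ℚ
  sign-multiple {e} (divides k e≡kn) = trans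
    (cong sign (trans e≡kn (trans (cong (k *_) n≡h+h) (ℕ.*-distribˡ-+ k (f + f) (f + f)))))
    (sign-double (k * (f + f)))

  -- If α^d ∼ α^e, then n divides both d + e(n − 1) and e + e(n − 1).
  sign-unique : ∀ d e → α ^ d ∼ α ^ e → sign d ≡ sign e
  sign-unique d e α^d∼α^e = *-cancel-inverse {c = sign (e * r)}
    (trans (sym (sign-+ d (e * r))) (sign-multiple n∣d+er))
    (trans (sym (sign-+ e (e * r))) (sign-multiple n∣e+er))
    where
    n∣e+er : n ∣ e + e * r
    n∣e+er = divides e (sym (ℕ.*-suc e r))
    n∣d+er : n ∣ d + e * r
    n∣d+er = n∣exponent (d + e * r) (begin
      α ^ (d + e * r)       ≡⟨ ℕ.^-distribˡ-+-* α d (e * r) ⟩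
      α ^ d * α ^ (e * r)   ≈⟨ *-congʳ (α ^ (e * r)) α^d∼α^e ⟩
      α ^ e * α ^ (e * r)   ≡⟨ ℕ.^-distribˡ-+-* α e (e * r) ⟨
      α ^ (e + e * r)       ≡⟨ cong (α ^_) (trans (sym (ℕ.*-suc e r)) (ℕ.*-comm e n)) ⟩
      α ^ (n * e)           ≡⟨ ℕ.^-*-assoc α n e ⟨
      (α ^ n) ^ e           ≈⟨ 1^ e α^n∼1 ⟩
      1                     ∎)

  -- The quadratic character and the principal character modulo `q`.

  data ResidueView (x : ℕ) : Set where
    isZero : x ∼ 0 → ResidueView x
    power  : ∀ e → x ∼ α ^ e → ResidueView x

  -- Opacity keeps `residueView x` a neutral term, so that matching on it in a proof also evaluates
  -- `χ x` and `ε x`.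
  abstract
    residueView : ∀ x → ResidueView x
    residueView x with x ∼? 0
    ... | yes x∼0 = isZero x∼0
    ... | no  x≁0 = power (log x x≁0 .proj₁) (log x x≁0 .proj₂)

  -- `χ` is the Legendre symbol and `ε` the principal character. The view supplies one of many
  -- possible exponents; `χ-power` shows that the choice does not matter.
  χ ε : ℕ → ℚ
  χ x with residueView x
  ... | isZero _  = 0ℚ
  ... | power e _ = sign e
  ε x with residueView x
  ... | isZero _  = 0ℚ
  ... | power _ _ = 1ℚ

  χ-zero : ∀ {x} → x ∼ 0 → χ x ≡ 0ℚ
  χ-zero {x} x∼0 with residueView x
  ... | isZero _      = refl
  ... | power e x∼α^e = contradiction (∼-trans (∼-sym x∼α^e) x∼0) (α^≁0 e)

  χ-power : ∀ {x} e → x ∼ α ^ e → χ x ≡ sign e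
  χ-power {x} e x∼α^e with residueView x
  ... | isZero x∼0     = contradiction (∼-trans (∼-sym x∼α^e) x∼0) (α^≁0 e)
  ... | power d x∼α^d = sign-unique d e (∼-trans (∼-sym x∼α^d) x∼α^e)

  ε-zero : ∀ {x} → x ∼ 0 → ε x ≡ 0ℚ
  ε-zero {x} x∼0 with residueView x
  ... | isZero _      = refl
  ... | power e x∼α^e = contradiction (∼-trans (∼-sym x∼α^e) x∼0) (α^≁0 e)

  ε-power : ∀ {x} e → x ∼ α ^ e → ε x ≡ 1ℚ
  ε-power {x} e x∼α^e with residueView x
  ... | isZero x∼0    = contradiction (∼-trans (∼-sym x∼α^e) x∼0) (α^≁0 e)
  ... | power _ _     = refl

  χ-cong : ∀ {x y} → x ∼ y → χ x ≡ χ y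
  χ-cong {x} {y} x∼y with residueView y
  ... | isZero y∼0    = χ-zero (∼-trans x∼y y∼0)
  ... | power e y∼α^e = χ-power e (∼-trans x∼y y∼α^e)

  ε-cong : ∀ {x y} → x ∼ y → ε x ≡ ε y
  ε-cong {x} {y} x∼y with residueView y
  ... | isZero y∼0    = ε-zero (∼-trans x∼y y∼0)
  ... | power e y∼α^e = ε-power e (∼-trans x∼y y∼α^e)

  -- Multiplicativity of `χ`: exponents add, and a zero factor makes both sides 0. The first factor
  -- is a given power of `α`, so only `y` needs a case distinction.
  χ-α^* : ∀ {x} e y → x ∼ α ^ e * y → χ x ≡ sign e ℚ.* χ y
  χ-α^* {x} e y x∼ with residueView y
  ... | isZero y∼0 = trans (χ-zero (begin
    x          ≈⟨ x∼ ⟩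
    α ^ e * y  ≈⟨ *-congˡ (α ^ e) y∼0 ⟩
    α ^ e * 0  ≡⟨ ℕ.*-zeroʳ (α ^ e) ⟩
    0          ∎)) (sym (ℚ.*-zeroʳ (sign e)))
  ... | power d y∼α^d = trans (χ-power (e + d) (begin
    x              ≈⟨ x∼ ⟩
    α ^ e * y      ≈⟨ *-congˡ (α ^ e) y∼α^d ⟩
    α ^ e * α ^ d  ≡⟨ ℕ.^-distribˡ-+-* α e d ⟨
    α ^ (e + d)    ∎)) (sign-+ e d)

  ε-α^* : ∀ {x} e y → x ∼ α ^ e * y → ε x ≡ ε y
  ε-α^* {x} e y x∼ with residueView y
  ... | isZero y∼0 = ε-zero (begin
    x          ≈⟨ x∼ ⟩
    α ^ e * y  ≈⟨ *-congˡ (α ^ e) y∼0 ⟩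
    α ^ e * 0  ≡⟨ ℕ.*-zeroʳ (α ^ e) ⟩
    0          ∎)
  ... | power d y∼α^d = ε-power (e + d) (begin
    x              ≈⟨ x∼ ⟩
    α ^ e * y      ≈⟨ *-congˡ (α ^ e) y∼α^d ⟩
    α ^ e * α ^ d  ≡⟨ ℕ.^-distribˡ-+-* α e d ⟨
    α ^ (e + d)    ∎)

  -- n represents −1; α raised to twice its exponent is 1, so 4f divides
  -- twice the exponent.
  n∼α^even : ∃[ e ] n ∼ α ^ e × sign e ≡ 1ℚ
  n∼α^even with log n (λ n∼0 → contradiction (∼⇒≡ (ℕ.n<1+n n) (s≤s z≤n) n∼0) λ ())
  ... | e , n∼α^e = e , n∼α^e , trans (cong sign e≡) (sign-double (k * f))
    where
    square : ∀ r → suc r * suc r ≡ 1 + r * suc (suc r)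
    square = solve-∀
    n∣e+e : n ∣ e + e
    n∣e+e = n∣exponent (e + e) (begin
      α ^ (e + e)    ≡⟨ ℕ.^-distribˡ-+-* α e e ⟩
      α ^ e * α ^ e  ≈⟨ *-cong n∼α^e n∼α^e ⟨
      n * n          ≡⟨ square r ⟩
      1 + r * q      ≈⟨ +-multiple 1 r ⟩
      1              ∎)
    k : ℕ
    k = _∣_.quotient n∣e+e
    e≡ : e ≡ k * f + k * f
    e≡ = double-injective (trans (_∣_.equality n∣e+e) (trans (cong (k *_) n≡h+h) (distribute k f)))
      where
      distribute : ∀ k f → k * ((f + f) + (f + f)) ≡ (k * f + k * f) + (k * f + k * f)
      distribute = solve-∀

  χ-neg : ∀ x → χ (n * x) ≡ χ x
  χ-neg x = let e , n∼α^e , even = n∼α^even in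
    trans (χ-α^* e x (*-congʳ x n∼α^e)) (trans (cong (ℚ._* χ x) even) (ℚ.*-identityˡ (χ x)))

  ε-neg : ∀ x → ε (n * x) ≡ ε x
  ε-neg x = let e , n∼α^e , _ = n∼α^even in ε-α^* e x (*-congʳ x n∼α^e)

  -- As r = q - 2, this is the inverse given by Fermat's little theorem. It is total, and it sends 0
  -- to 0, so it permutes all residues.
  inv : ℕ → ℕ
  inv x = x ^ r

  inv-zero : ∀ {x} → x ∼ 0 → inv x ∼ 0
  inv-zero x∼0 = ∼-trans (^-congˡ r x∼0) (∼-reflexive (0^r≡0 r (f + f) n≡h+h))
    where
    -- Since 0 ^ 0 is 1, the case r = 0 has to be excluded: `n` would be 1, which is odd.
    0^r≡0 : ∀ r h → suc r ≡ h + h → 0 ^ r ≡ 0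
    0^r≡0 zero    (suc h) eq = contradiction (trans eq (cong suc (ℕ.+-suc h h))) λ ()
    0^r≡0 (suc r) h       eq = refl

  -- The product is x^n by definition, and with x ∼ α^e this is (α^n)^e.
  *-inv : ∀ {x} → ¬ (x ∼ 0) → x * inv x ∼ 1
  *-inv {x} x≁0 with e , x∼α^e ← log x x≁0 = begin
    x ^ n        ≈⟨ ^-congˡ n x∼α^e ⟩
    (α ^ e) ^ n  ≡⟨ ℕ.^-*-assoc α e n ⟩
    α ^ (e * n)  ≡⟨ cong (α ^_) (ℕ.*-comm e n) ⟩
    α ^ (n * e)  ≡⟨ ℕ.^-*-assoc α n e ⟨
    (α ^ n) ^ e  ≈⟨ 1^ e α^n∼1 ⟩
    1            ∎

  inv-inv : ∀ x → inv (inv x) ∼ x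
  inv-inv x with x ∼? 0
  ... | yes x∼0 = ∼-trans (inv-zero (inv-zero x∼0)) (∼-sym x∼0)
  ... | no  x≁0 = begin
    inv (inv x)                  ≡⟨ ℕ.*-identityˡ (inv (inv x)) ⟨
    1 * inv (inv x)              ≈⟨ *-congʳ (inv (inv x)) (*-inv x≁0) ⟨
    x * inv x * inv (inv x)      ≡⟨ ℕ.*-assoc x (inv x) (inv (inv x)) ⟩
    x * (inv x * inv (inv x))    ≈⟨ *-congˡ x (*-inv inv≁0) ⟩
    x * 1                        ≡⟨ ℕ.*-identityʳ x ⟩
    x                            ∎
    where
    inv≁0 : ¬ (inv x ∼ 0)
    inv≁0 inv∼0 = 1≁0 (begin
      1          ≈⟨ *-inv x≁0 ⟨
      x * inv x  ≈⟨ *-congˡ x inv∼0 ⟩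
      x * 0      ≡⟨ ℕ.*-zeroʳ x ⟩
      0          ∎)

  -- Substitutions in sums over all residues.

  module _ (F : ℕ → ℚ) (F-cong : ∀ {i j} → i ∼ j → F i ≡ F j) where

    ∑-shift : ∀ t → ∑ (λ i → F (t + i)) ≡ ∑ F
    -- `n * t` represents -t, so adding it undoes the shift.
    ∑-shift t = ∑-reindex F F-cong (t +_) (n * t +_) (+-cong ∼-refl) (+-cong (∼-refl {n * t}))
      (λ i → ∼-trans (∼-reflexive (there n t i)) (+-multiple i t))
      (λ i → ∼-trans (∼-reflexive (back n t i)) (+-multiple i t))
      where
      there : ∀ n t i → t + (n * t + i) ≡ i + t * suc n
      there = solve-∀
      back : ∀ n t i → n * t + (t + i) ≡ i + t * suc n
      back = solve-∀

    ∑-scale : ∀ {c} → ¬ (c ∼ 0) → ∑ (λ i → F (c * i)) ≡ ∑ F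
    ∑-scale {c} c≁0 = ∑-reindex F F-cong (c *_) (inv c *_) (*-congˡ c) (*-congˡ (inv c))
      (λ i → ∼-trans (∼-reflexive (sym (ℕ.*-assoc c (inv c) i))) (cancel i (*-inv c≁0)))
      (λ i → ∼-trans (∼-reflexive (sym (ℕ.*-assoc (inv c) c i)))
        (cancel i (∼-trans (∼-reflexive (ℕ.*-comm (inv c) c)) (*-inv c≁0))))
      where
      cancel : ∀ {d} i → d ∼ 1 → d * i ∼ i
      cancel i d∼1 = ∼-trans (*-congʳ i d∼1) (∼-reflexive (ℕ.*-identityˡ i))

    ∑-inv : ∑ (λ i → F (inv i)) ≡ ∑ F
    ∑-inv = ∑-reindex F F-cong inv inv (^-congˡ r) (^-congˡ r) inv-inv inv-inv

    -- The map i ↦ -(i + t) is its own inverse modulo `q`.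
    ∑-reflect : ∀ t → ∑ (λ i → F (n * (i + t))) ≡ ∑ F
    ∑-reflect t = ∑-reindex F F-cong reflect reflect reflect-cong reflect-cong involutive involutive
      where
      reflect : ℕ → ℕ
      reflect i = n * (i + t)
      reflect-cong : ∀ {i j} → i ∼ j → reflect i ∼ reflect j
      reflect-cong i∼j = *-congˡ n (+-cong i∼j ∼-refl)
      expand : ∀ r t i → suc r * (suc r * (i + t) + t) ≡ i + (r * i + suc r * t) * suc (suc r)
      expand = solve-∀
      involutive : ∀ i → reflect (reflect i) ∼ i
      involutive i = ∼-trans (∼-reflexive (expand r t i)) (+-multiple i (r * i + n * t))

  -- The reflection takes the pair (i, i + t) to (-(i + t), -i), so up to sign it exchanges the two
  -- arguments of a correlation.
  reflect-+ : ∀ i t → n * (i + t) + t ∼ n * i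
  reflect-+ i t = ∼-trans (∼-reflexive (expand n i t)) (+-multiple (n * i) t)
    where
    expand : ∀ n i t → n * (i + t) + t ≡ n * i + t * suc n
    expand = solve-∀

  1+*-zero : ∀ t {j} → j ∼ 0 → 1 + t * j ∼ 1
  1+*-zero t j∼0 = +-cong (∼-refl {1}) (∼-trans (*-congˡ t j∼0) (∼-reflexive (ℕ.*-zeroʳ t)))

  -- χ(i)χ(i + t) = χ(1 + t i⁻¹) for i ≠ 0, as χ(i)² = 1.
  χ-product : ∀ i t → χ i ℚ.* χ (i + t) ℚ.+ 1ℚ ≡ χ (1 + t * inv i) ℚ.+ ε i
  χ-product i t with residueView i
  -- For `i` ∼ 0 the inverse is 0 too, and the right side is χ(1) = 1, matching the 1 added on the
  -- left. For a unit, that 1 is `ε i`.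
  ... | isZero i∼0 = trans (cong (ℚ._+ 1ℚ) (ℚ.*-zeroˡ (χ (i + t))))
    (cong (ℚ._+ 0ℚ) (sym (χ-power 0 (1+*-zero t (inv-zero i∼0)))))
  ... | power e i∼α^e = cong (ℚ._+ 1ℚ) (trans
    (cong (sign e ℚ.*_) (χ-α^* e (1 + t * inv i) factor))
    (trans (sym (ℚ.*-assoc (sign e) (sign e) (χ (1 + t * inv i))))
      (trans (cong (ℚ._* χ (1 + t * inv i)) (trans (sym (sign-+ e e)) (sign-double e)))
        (ℚ.*-identityˡ (χ (1 + t * inv i))))))
    where
    factor : i + t ∼ α ^ e * (1 + t * inv i)
    factor = begin
      i + t                    ≡⟨ cong (i +_) (ℕ.*-identityʳ t) ⟨
      i + t * 1                ≈⟨ +-cong (∼-refl {i}) (*-congˡ t (*-inv (λ i∼0 → α^≁0 e (∼-trans (∼-sym i∼α^e) i∼0)))) ⟨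
      i + t * (i * inv i)      ≡⟨ expand i t (inv i) ⟩
      i * (1 + t * inv i)      ≈⟨ *-congʳ (1 + t * inv i) i∼α^e ⟩
      α ^ e * (1 + t * inv i)  ∎
      where
      expand : ∀ i t j → i + t * (i * j) ≡ i * (1 + t * j)
      expand = solve-∀

  -- This is (1 - ε(i))(1 - ε(i + t)) = 0: as `t` is not 0, the residues i and i + t are not both 0.
  ε-product : ∀ i {t} → ¬ (t ∼ 0) → ε i ℚ.* ε (i + t) ℚ.+ 1ℚ ≡ ε i ℚ.+ ε (i + t)
  ε-product i {t} t≁0 with residueView i
  ... | power e _ = solve 1 (λ p → con 1ℚ :* p :+ con 1ℚ := con 1ℚ :+ p) refl (ε (i + t))
  ... | isZero i∼0 = let e , t∼α^e = log t t≁0 in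
    trans (cong (ℚ._+ 1ℚ) (ℚ.*-zeroˡ (ε (i + t))))
      (cong (0ℚ ℚ.+_) (sym (ε-power e (∼-trans (+-cong i∼0 (∼-refl {t})) t∼α^e))))

-- Character sums and the correlations of the two indicators.

module CharacterSums
  (f r : ℕ) (n≡4f : suc r ≡ 4 ℕ.* f) (q-prime : Prime (suc (suc r)))
  (g : Fin (suc (suc r))) (generator : IsGenerator (suc (suc r)) g) where

  open QuadraticCharacter f r n≡4f q-prime g generator public
  open import Data.Rational.Base using (_+_; _*_; _-_; -_)
  open ≡-Reasoning

  -- Multiplication by the nonresidue `α` permutes the residues and changes the sign of `χ`, so the
  -- sum equals its own negative.
  ∑χ≡0 : ∑ χ ≡ 0ℚ
  ∑χ≡0 = trans (solve 1 (λ s → s := con ½ :* (s :+ s)) refl (∑ χ)) (cong (½ *_) (begin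
    ∑ χ + ∑ χ                          ≡⟨ cong (_+ ∑ χ) (∑-scale χ χ-cong (α^≁0 1)) ⟨
    ∑ (λ i → χ (α ℕ.^ 1 ℕ.* i)) + ∑ χ  ≡⟨ ∑-+ (λ i → χ (α ℕ.^ 1 ℕ.* i)) χ ⟨
    ∑ (λ i → χ (α ℕ.^ 1 ℕ.* i) + χ i)  ≡⟨ ∑-cong (λ i → trans (cong (_+ χ i) (χ-α^* 1 i ∼-refl)) (cancel (χ i))) ⟩
    ∑ (λ _ → 0ℚ)                       ≡⟨ ℚΣ.sum-replicate-zero q ⟩
    0ℚ                                 ∎))
    where
    cancel : ∀ p → (- 1ℚ) * p + p ≡ 0ℚ
    cancel = solve 1 (λ p → (:- con 1ℚ) :* p :+ p := con 0ℚ) refl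

  -- The summand at 0 is split off; `ε` is 1 at all others. The number q stays a sum of ones until
  -- `sum-1` evaluates it.
  ∑ε : ∑ (λ _ → 1ℚ) ≡ 1ℚ + ∑ ε
  ∑ε = cong (1ℚ +_) (begin
    ℚΣ.sum {n} (λ _ → 1ℚ)              ≡⟨ ℚΣ.sum-cong-≗ {n} (λ i → sym (ε-suc i)) ⟩
    tail                            ≡⟨ ℚ.+-identityˡ tail ⟨
    0ℚ + tail                       ≡⟨ cong (_+ tail) (ε-zero {0} ∼-refl) ⟨
    ∑ ε                             ∎)
    where
    tail : ℚ
    tail = ℚΣ.sum {n} (λ i → ε (toℕ (suc i)))
    ε-suc : ∀ i → ε (toℕ (suc i)) ≡ 1ℚ
    ε-suc i with e , eq ← log (toℕ (suc i)) (λ i∼0 → contradiction (∼⇒≡ (toℕ<n (suc i)) (s≤s z≤n) i∼0) λ ()) =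
      ε-power e eq

  -- The indicator functions of 𝔇₀ and 𝔇₁.
  u w : ℕ → ℚ
  u i = ½ * (ε i + χ i)
  w i = ½ * (ε i - χ i)

  u-zero : ∀ {i} → i ∼ 0 → u i ≡ 0ℚ
  u-zero i∼0 = cong₂ (λ a b → ½ * (a + b)) (ε-zero i∼0) (χ-zero i∼0)

  w-zero : ∀ {i} → i ∼ 0 → w i ≡ 0ℚ
  w-zero i∼0 = cong₂ (λ a b → ½ * (a - b)) (ε-zero i∼0) (χ-zero i∼0)

  -- Only the parity of the exponent matters, so `e` may be traded for the class index `k`.
  u-power : ∀ {i} e k → i ∼ α ℕ.^ e → sign e ≡ sign k → u i ≡ ½ * (1ℚ + sign k)
  u-power e k i∼α^e eq = cong₂ (λ a b → ½ * (a + b)) (ε-power e i∼α^e) (trans (χ-power e i∼α^e) eq)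

  w-power : ∀ {i} e k → i ∼ α ℕ.^ e → sign e ≡ sign k → w i ≡ ½ * (1ℚ - sign k)
  w-power e k i∼α^e eq = cong₂ (λ a b → ½ * (a - b)) (ε-power e i∼α^e) (trans (χ-power e i∼α^e) eq)

  u-cong : ∀ {i j} → i ∼ j → u i ≡ u j
  u-cong i∼j = cong₂ (λ a b → ½ * (a + b)) (ε-cong i∼j) (χ-cong i∼j)

  w-cong : ∀ {i j} → i ∼ j → w i ≡ w j
  w-cong i∼j = cong₂ (λ a b → ½ * (a - b)) (ε-cong i∼j) (χ-cong i∼j)

  u-neg : ∀ i → u (n ℕ.* i) ≡ u i
  u-neg i = cong₂ (λ a b → ½ * (a + b)) (ε-neg i) (χ-neg i)

  w-neg : ∀ i → w (n ℕ.* i) ≡ w i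
  w-neg i = cong₂ (λ a b → ½ * (a - b)) (ε-neg i) (χ-neg i)

  ∑-antisymmetric : ∀ t → ∑ (λ i → w i * u (i ℕ.+ t) - u i * w (i ℕ.+ t)) ≡ 0ℚ
  ∑-antisymmetric t = begin
    -- Adding and subtracting ∑ uw lets the additivity of `∑` separate the two halves.
    ∑ antisymmetric                        ≡⟨ solve 2 (λ s p → s := s :+ p :- p) refl (∑ antisymmetric) (∑ uw) ⟩
    ∑ antisymmetric + ∑ uw - ∑ uw          ≡⟨ cong (_- ∑ uw) (∑-+ antisymmetric uw) ⟨
    ∑ (λ i → antisymmetric i + uw i) - ∑ uw ≡⟨ cong (_- ∑ uw) (∑-cong λ i → solve 2 (λ a b → a :- b :+ b := a) refl (wu i) (uw i)) ⟩
    ∑ wu - ∑ uw                            ≡⟨ cong (_- ∑ uw) (∑-reflect wu wu-cong t) ⟨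
    ∑ (λ i → wu (n ℕ.* (i ℕ.+ t))) - ∑ uw  ≡⟨ cong (_- ∑ uw) (∑-cong reflected) ⟩
    ∑ uw - ∑ uw                            ≡⟨ ℚ.+-inverseʳ (∑ uw) ⟩
    0ℚ                                     ∎
    where
    wu uw antisymmetric : ℕ → ℚ
    wu i = w i * u (i ℕ.+ t)
    uw i = u i * w (i ℕ.+ t)
    antisymmetric i = wu i - uw i
    wu-cong : ∀ {i j} → i ∼ j → wu i ≡ wu j
    wu-cong i∼j = cong₂ _*_ (w-cong i∼j) (u-cong (+-cong i∼j ∼-refl))
    reflected : ∀ i → wu (n ℕ.* (i ℕ.+ t)) ≡ uw i
    reflected i = trans
      (cong₂ _*_ (w-neg (i ℕ.+ t)) (trans (u-cong (reflect-+ i t)) (u-neg i)))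
      (ℚ.*-comm (w (i ℕ.+ t)) (u i))

  -- By `total`, 2S + 2Q = 3E, where Q is the number of residues and E = Q - 1. Hence S = ½(3(Q - 1)
  -- - 2Q) = ½(Q - 3).
  ∑-symmetric : ∀ {t} → ¬ (t ∼ 0) →
    ∑ (λ i → u i * u (i ℕ.+ t) + w i * w (i ℕ.+ t)) ≡ ½ * (∑ (λ _ → 1ℚ) - (1ℚ + 1ℚ + 1ℚ))
  ∑-symmetric {t} t≁0 = begin
    S                           ≡⟨ solve 2 (λ s c → s := con ½ :* (s :+ s :+ (c :+ c) :- (c :+ c))) refl S Q ⟩
    ½ * (S + S + (Q + Q) - (Q + Q)) ≡⟨ cong (λ p → ½ * (p - (Q + Q))) total ⟩
    ½ * (E + E + (0ℚ + E) - (Q + Q)) ≡⟨ cong (λ p → ½ * (E + E + (0ℚ + E) - (p + p))) ∑ε ⟩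
    ½ * (E + E + (0ℚ + E) - ((1ℚ + E) + (1ℚ + E))) ≡⟨ solve 1 (λ e →
        con ½ :* (e :+ e :+ (con 0ℚ :+ e) :- ((con 1ℚ :+ e) :+ (con 1ℚ :+ e)))
          := con ½ :* (con 1ℚ :+ e :- con (1ℚ + 1ℚ + 1ℚ))) refl E ⟩
    ½ * (1ℚ + E - (1ℚ + 1ℚ + 1ℚ)) ≡⟨ cong (λ p → ½ * (p - (1ℚ + 1ℚ + 1ℚ))) ∑ε ⟨
    ½ * (Q - (1ℚ + 1ℚ + 1ℚ))    ∎
    where
    s χ′ : ℕ → ℚ
    s i = u i * u (i ℕ.+ t) + w i * w (i ℕ.+ t)
    χ′ i = χ (1 ℕ.+ t ℕ.* inv i)
    S Q E : ℚ
    S = ∑ s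
    Q = ∑ (λ _ → 1ℚ)
    E = ∑ ε
    -- Here 2(uu′ + ww′) = εε′ + χχ′. Of the two added ones, the first goes to `ε-product` and the
    -- second to `χ-product`.
    pointwise : ∀ i → s i + s i + (1ℚ + 1ℚ) ≡ ε i + ε (i ℕ.+ t) + (χ′ i + ε i)
    pointwise i = trans
      (solve 4 (λ a b c d →
        let p = con ½ :* (a :+ b) :* (con ½ :* (c :+ d)) :+ con ½ :* (a :- b) :* (con ½ :* (c :- d)) in
        p :+ p :+ con (1ℚ + 1ℚ) := a :* c :+ con 1ℚ :+ (b :* d :+ con 1ℚ)) refl
        (ε i) (χ i) (ε (i ℕ.+ t)) (χ (i ℕ.+ t)))
      (cong₂ _+_ (ε-product i t≁0) (χ-product i t))
    ∑-shiftʳ : ∑ (λ i → ε (i ℕ.+ t)) ≡ E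
    ∑-shiftʳ = trans (∑-cong λ i → cong ε (ℕ.+-comm i t)) (∑-shift ε ε-cong t)
    -- The summand at i = 0 is χ(1), so 1 + t i⁻¹ runs through all residues and the whole sum of `χ`
    -- appears.
    ∑χ′ : ∑ χ′ ≡ 0ℚ
    ∑χ′ = begin
      ∑ χ′                               ≡⟨ ∑-inv (λ i → χ (1 ℕ.+ t ℕ.* i)) (λ i∼j → χ-cong (+-cong (∼-refl {1}) (*-congˡ t i∼j))) ⟩
      ∑ (λ i → χ (1 ℕ.+ t ℕ.* i))        ≡⟨ ∑-scale (λ i → χ (1 ℕ.+ i)) (λ i∼j → χ-cong (+-cong (∼-refl {1}) i∼j)) t≁0 ⟩
      ∑ (λ i → χ (1 ℕ.+ i))              ≡⟨ ∑-shift χ χ-cong 1 ⟩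
      ∑ χ                                ≡⟨ ∑χ≡0 ⟩
      0ℚ                                 ∎
    total : S + S + (Q + Q) ≡ E + E + (0ℚ + E)
    total = begin
      S + S + (Q + Q)   ≡⟨ cong₂ _+_ (∑-+ s s) (∑-+ (λ _ → 1ℚ) (λ _ → 1ℚ)) ⟨
      ∑ (λ i → s i + s i) + ∑ (λ _ → 1ℚ + 1ℚ) ≡⟨ ∑-+ (λ i → s i + s i) (λ _ → 1ℚ + 1ℚ) ⟨
      ∑ (λ i → s i + s i + (1ℚ + 1ℚ)) ≡⟨ ∑-cong pointwise ⟩
      ∑ (λ i → ε i + ε (i ℕ.+ t) + (χ′ i + ε i)) ≡⟨ ∑-+ (λ i → ε i + ε (i ℕ.+ t)) (λ i → χ′ i + ε i) ⟩
      ∑ (λ i → ε i + ε (i ℕ.+ t)) + ∑ (λ i → χ′ i + ε i) ≡⟨ cong₂ _+_ (∑-+ ε (λ i → ε (i ℕ.+ t))) (∑-+ χ′ ε) ⟩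
      E + ∑ (λ i → ε (i ℕ.+ t)) + (∑ χ′ + E) ≡⟨ cong₂ (λ a b → E + a + (b + E)) ∑-shiftʳ ∑χ′ ⟩
      E + E + (0ℚ + E)  ∎

open import Defs using (IsNull; ℝ; mkℝ; seq; cauchy)

-- Null sequences of rationals.

module NullSequences where

  open import Data.Rational.Base hiding (NonZero)
  open ℚ.≤-Reasoning

  private
    0<½* : ∀ {ε} → 0ℚ < ε → 0ℚ < ½ * ε
    0<½* {ε} 0<ε = subst (_< ½ * ε) (ℚ.*-zeroʳ ½) (ℚ.*-monoʳ-<-pos ½ 0<ε)

    halve : ∀ ε → ½ * ε + ½ * ε ≡ ε
    halve ε = trans (sym (ℚ.*-distribʳ-+ ε ½ ½)) (ℚ.*-identityˡ ε)

    ∣p∣≤∣p-q∣+∣q∣ : ∀ p q → ∣ p ∣ ≤ ∣ p - q ∣ + ∣ q ∣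
    ∣p∣≤∣p-q∣+∣q∣ p q = begin
      ∣ p ∣               ≡⟨ cong ∣_∣ (solve 2 (λ p q → p := p :- q :+ q) refl p q) ⟩
      ∣ p - q + q ∣       ≤⟨ ℚ.∣p+q∣≤∣p∣+∣q∣ (p - q) q ⟩
      ∣ p - q ∣ + ∣ q ∣   ∎

  null-cong : ∀ {u v} → (∀ k → u k ≡ v k) → IsNull u → IsNull v
  null-cong u≗v nu ε 0<ε with N , h ← nu ε 0<ε =
    N , λ n le → subst (λ p → ∣ p ∣ < ε) (u≗v n) (h n le)

  null-0 : IsNull (λ _ → 0ℚ)
  null-0 ε 0<ε = 0 , λ _ _ → 0<ε

  null-+ : ∀ {u v} → IsNull u → IsNull v → IsNull (λ k → u k + v k)
  null-+ {u} {v} nu nv ε 0<ε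
    with M , hu ← nu (½ * ε) (0<½* 0<ε)
       | N , hv ← nv (½ * ε) (0<½* 0<ε)
    = M ℕ.⊔ N , λ n le → begin-strict
      ∣ u n + v n ∣      ≤⟨ ℚ.∣p+q∣≤∣p∣+∣q∣ (u n) (v n) ⟩
      ∣ u n ∣ + ∣ v n ∣  <⟨ ℚ.+-mono-< (hu n (ℕ.m⊔n≤o⇒m≤o M N le)) (hv n (ℕ.m⊔n≤o⇒n≤o M N le)) ⟩
      ½ * ε + ½ * ε      ≡⟨ halve ε ⟩
      ε                  ∎

  null-neg : ∀ {u} → IsNull u → IsNull (λ k → - u k)
  null-neg {u} nu ε 0<ε with N , h ← nu ε 0<ε =
    N , λ n le → subst (_< ε) (sym (ℚ.∣-p∣≡∣p∣ (u n))) (h n le)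

  -- A Cauchy sequence is eventually bounded by some K > 0, so it suffices to bring `v` below ε/K.
  null-*ˡ : ∀ x {v} → IsNull v → IsNull (λ k → seq x k * v k)
  null-*ˡ x {v} nv ε 0<ε with N , hu ← cauchy x 1ℚ (ℚ.positive⁻¹ 1ℚ) = bound
    where
    u : ℕ → ℚ
    u = seq x
    K : ℚ
    K = 1ℚ + ∣ u N ∣
    instance
      K-pos : Positive K
      K-pos = ℚ.pos+nonNeg⇒pos 1ℚ ∣ u N ∣ ⦃ ℚ.∣-∣-nonNeg (u N) ⦄
      K-nonZero : ℚ.NonZero K
      K-nonZero = ℚ.pos⇒nonZero K
      1/K-pos : Positive (1/ K)
      1/K-pos = ℚ.1/pos⇒pos K
    0<δ : 0ℚ < 1/ K * ε
    0<δ = subst (_< 1/ K * ε) (ℚ.*-zeroʳ (1/ K)) (ℚ.*-monoʳ-<-pos (1/ K) 0<ε)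
    u≤K : ∀ n → N ℕ.≤ n → ∣ u n ∣ ≤ K
    u≤K n le = ℚ.≤-trans (∣p∣≤∣p-q∣+∣q∣ (u n) (u N))
      (ℚ.+-monoˡ-≤ ∣ u N ∣ (ℚ.<⇒≤ (hu n N le ℕ.≤-refl)))
    bound : ∃[ L ] (∀ n → L ℕ.≤ n → ∣ u n * v n ∣ < ε)
    bound with M , hv ← nv (1/ K * ε) 0<δ = N ℕ.⊔ M , λ n le → begin-strict
      ∣ u n * v n ∣      ≡⟨ ℚ.∣p*q∣≡∣p∣*∣q∣ (u n) (v n) ⟩
      ∣ u n ∣ * ∣ v n ∣  ≤⟨ ℚ.*-monoʳ-≤-nonNeg ∣ v n ∣ ⦃ ℚ.∣-∣-nonNeg (v n) ⦄ (u≤K n (ℕ.m⊔n≤o⇒m≤o N M le)) ⟩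
      K * ∣ v n ∣        <⟨ ℚ.*-monoʳ-<-pos K (hv n (ℕ.m⊔n≤o⇒n≤o N M le)) ⟩
      K * (1/ K * ε)     ≡⟨ ℚ.*-assoc K (1/ K) ε ⟨
      K * 1/ K * ε       ≡⟨ cong (_* ε) (ℚ.*-inverseʳ K) ⟩
      1ℚ * ε             ≡⟨ ℚ.*-identityˡ ε ⟩
      ε                  ∎

  -- Where |u| ≥ η, the bound |uv| < ηε forces |v| < ε.
  null-quotient : ∀ {u v : ℕ → ℚ} η → 0ℚ < η → ∃[ N ] (∀ n → N ℕ.≤ n → η ≤ ∣ u n ∣) →
    IsNull (λ k → u k * v k) → IsNull v
  null-quotient {u} {v} η 0<η (N , hu) nuv ε 0<ε
    with M , h ← nuv (η * ε) (subst (_< η * ε) (ℚ.*-zeroʳ η)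
                                (ℚ.*-monoʳ-<-pos η ⦃ positive 0<η ⦄ 0<ε))
    = N ℕ.⊔ M , λ n le → ℚ.*-cancelˡ-<-nonNeg η ⦃ nonNegative (ℚ.<⇒≤ 0<η) ⦄ (begin-strict
      η * ∣ v n ∣        ≤⟨ ℚ.*-monoʳ-≤-nonNeg ∣ v n ∣ ⦃ ℚ.∣-∣-nonNeg (v n) ⦄ (hu n (ℕ.m⊔n≤o⇒m≤o N M le)) ⟩
      ∣ u n ∣ * ∣ v n ∣  ≡⟨ ℚ.∣p*q∣≡∣p∣*∣q∣ (u n) (v n) ⟨
      ∣ u n * v n ∣      <⟨ h n (ℕ.m⊔n≤o⇒n≤o N M le) ⟩
      η * ε              ∎)

  -- At scale ε a Cauchy sequence is decidably either small or bounded away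
  -- from 0, and the latter would make v null.
  null-cancelʳ : ∀ x {v} → IsNull (λ k → seq x k * v k) → ¬ IsNull v → IsNull (seq x)
  null-cancelʳ (mkℝ u cu) nuv ¬nv ε 0<ε with N , hu ← cu (½ * (½ * ε)) (0<½* (0<½* 0<ε))
    -- Beyond `N` the terms stay within ε/4 of `u N`. Below the threshold ε/2 they are less than
    -- 3ε/4 in absolute value; otherwise they are at least ε/4.
    with ∣ u N ∣ ℚ.<? ½ * ε
  ... | yes small = N , λ n le → begin-strict
    ∣ u n ∣                ≤⟨ ∣p∣≤∣p-q∣+∣q∣ (u n) (u N) ⟩
    ∣ u n - u N ∣ + ∣ u N ∣  <⟨ ℚ.+-mono-< (hu n N le ℕ.≤-refl) small ⟩
    η + ½ * ε              ≡⟨ cong (η +_) (halve (½ * ε)) ⟨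
    η + (η + η)            <⟨ ℚ.+-monoˡ-< (η + η) η<η+η ⟩
    (η + η) + (η + η)      ≡⟨ cong₂ _+_ (halve (½ * ε)) (halve (½ * ε)) ⟩
    ½ * ε + ½ * ε          ≡⟨ halve ε ⟩
    ε                      ∎
    where
    η : ℚ
    η = ½ * (½ * ε)
    η<η+η : η < η + η
    η<η+η = begin-strict
      η       ≡⟨ ℚ.+-identityʳ η ⟨
      η + 0ℚ  <⟨ ℚ.+-monoʳ-< η (0<½* (0<½* 0<ε)) ⟩
      η + η   ∎
  ... | no large = contradiction (null-quotient {u} η (0<½* (0<½* 0<ε)) (N , away) nuv) ¬nv
    where
    η : ℚ
    η = ½ * (½ * ε)
    away : ∀ n → N ℕ.≤ n → η ≤ ∣ u n ∣
    away n le = begin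
      η                                  ≡⟨ solve 1 (λ η → η := con 0ℚ :- η :+ (η :+ η)) refl η ⟩
      0ℚ - η + (η + η)                   ≡⟨ cong (0ℚ - η +_) (halve (½ * ε)) ⟩
      0ℚ - η + ½ * ε                     ≤⟨ ℚ.+-monoʳ-≤ (0ℚ - η) (ℚ.≮⇒≥ large) ⟩
      0ℚ - η + ∣ u N ∣                   ≤⟨ ℚ.+-monoʳ-≤ (0ℚ - η) (∣p∣≤∣p-q∣+∣q∣ (u N) (u n)) ⟩
      0ℚ - η + (∣ u N - u n ∣ + ∣ u n ∣) ≤⟨ ℚ.+-monoʳ-≤ (0ℚ - η) (ℚ.+-monoˡ-≤ ∣ u n ∣ (ℚ.<⇒≤ (hu N n ℕ.≤-refl le))) ⟩
      0ℚ - η + (η + ∣ u n ∣)             ≡⟨ solve 2 (λ η p → con 0ℚ :- η :+ (η :+ p) := p) refl η ∣ u n ∣ ⟩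
      ∣ u n ∣                            ∎

  0≤p*p : ∀ p → 0ℚ ≤ p * p
  0≤p*p p = subst (0ℚ ≤_) ∣p∣²≡p²
    (ℚ.nonNegative⁻¹ (∣ p ∣ * ∣ p ∣) ⦃ ℚ.nonNeg*nonNeg⇒nonNeg (∣ p ∣) (∣ p ∣) ⦄)
    where
    instance
      ∣p∣≥0 : NonNegative ∣ p ∣
      ∣p∣≥0 = ℚ.∣-∣-nonNeg p
    ∣p∣²≡p² : ∣ p ∣ * ∣ p ∣ ≡ p * p
    ∣p∣²≡p² with ℚ.∣p∣≡p∨∣p∣≡-p p
    ... | inj₁ eq = cong₂ _*_ eq eq
    ... | inj₂ eq = trans (cong₂ _*_ eq eq) (solve 1 (λ p → :- p :* :- p := p :* p) refl p)

  -- Every term is at least 1. This is how it enters the argument that -1 is not a square in ℝ.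
  ¬null-1+square : ∀ (u : ℕ → ℚ) → ¬ IsNull (λ k → 1ℚ + u k * u k)
  ¬null-1+square u nu with N , h ← nu 1ℚ (ℚ.positive⁻¹ 1ℚ) = ℚ.<-irrefl refl (ℚ.≤-<-trans 1≤ (h N ℕ.≤-refl))
    where
    1≤1+u² : 1ℚ ≤ 1ℚ + u N * u N
    1≤1+u² = ℚ.+-monoʳ-≤ 1ℚ (0≤p*p (u N))
    1≤ : 1ℚ ≤ ∣ 1ℚ + u N * u N ∣
    1≤ = subst (1ℚ ≤_) (sym (ℚ.0≤p⇒∣p∣≡p (ℚ.≤-trans (ℚ.nonNegative⁻¹ 1ℚ) 1≤1+u²))) 1≤1+u²

open import Defs

-- Complex arithmetic and primitive fourth roots of unity.

module ComplexArithmetic where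

  open NullSequences
  open import Data.Rational.Base using () renaming (_+_ to _⊕_; _*_ to _⊗_; _-_ to _⊖_; -_ to ⊖_)

  ≈ᵣ-trans : ∀ {x y z} → x ≈ᵣ y → y ≈ᵣ z → x ≈ᵣ z
  ≈ᵣ-trans {x} {y} {z} (mk≈ᵣ x-y) (mk≈ᵣ y-z) = mk≈ᵣ (null-cong
    (λ k → solve 3 (λ x y z → x :- y :+ (y :- z) := x :- z) refl (seq x k) (seq y k) (seq z k))
    (null-+ x-y y-z))

  ≈ᵣ-pointwise : ∀ {x y} → (∀ k → seq x k ≡ seq y k) → x ≈ᵣ y
  ≈ᵣ-pointwise {x} {y} x≗y = mk≈ᵣ (null-cong
    (λ k → trans (sym (ℚ.+-inverseʳ (seq y k))) (cong (_⊖ seq y k) (sym (x≗y k)))) null-0)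

  +ᵣ-cong : ∀ {x x′ y y′} → x ≈ᵣ x′ → y ≈ᵣ y′ → x +ᵣ y ≈ᵣ x′ +ᵣ y′
  +ᵣ-cong {x} {x′} {y} {y′} (mk≈ᵣ x-x′) (mk≈ᵣ y-y′) = mk≈ᵣ (null-cong
    (λ k → solve 4 (λ x x′ y y′ → x :- x′ :+ (y :- y′) := x :+ y :- (x′ :+ y′)) refl
      (seq x k) (seq x′ k) (seq y k) (seq y′ k))
    (null-+ x-x′ y-y′))

  -ᵣ-cong : ∀ {x x′} → x ≈ᵣ x′ → -ᵣ x ≈ᵣ -ᵣ x′
  -ᵣ-cong {x} {x′} (mk≈ᵣ x-x′) = mk≈ᵣ (null-cong
    (λ k → solve 2 (λ x x′ → :- (x :- x′) := :- x :- :- x′) refl (seq x k) (seq x′ k))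
    (null-neg x-x′))

  *ᵣ-cong : ∀ {x x′ y y′} → x ≈ᵣ x′ → y ≈ᵣ y′ → x *ᵣ y ≈ᵣ x′ *ᵣ y′
  *ᵣ-cong {x} {x′} {y} {y′} (mk≈ᵣ x-x′) (mk≈ᵣ y-y′) = mk≈ᵣ (null-cong
    (λ k → solve 4 (λ x x′ y y′ → y :* (x :- x′) :+ x′ :* (y :- y′) := x :* y :- x′ :* y′) refl
      (seq x k) (seq x′ k) (seq y k) (seq y′ k))
    (null-+ (null-*ˡ y x-x′) (null-*ˡ x′ y-y′)))

  ≈-trans : ∀ {z w v} → z ≈ w → w ≈ v → z ≈ v
  ≈-trans (mk≈ re≈ im≈) (mk≈ re≈′ im≈′) = mk≈ (≈ᵣ-trans re≈ re≈′) (≈ᵣ-trans im≈ im≈′)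

  +-cong : ∀ {z z′ w w′} → z ≈ z′ → w ≈ w′ → z + w ≈ z′ + w′
  +-cong (mk≈ re≈ im≈) (mk≈ re≈′ im≈′) = mk≈ (+ᵣ-cong re≈ re≈′) (+ᵣ-cong im≈ im≈′)

  *-cong : ∀ {z z′ w w′} → z ≈ z′ → w ≈ w′ → z * w ≈ z′ * w′
  *-cong (mk≈ re≈ im≈) (mk≈ re≈′ im≈′) = mk≈
    (+ᵣ-cong (*ᵣ-cong re≈ re≈′) (-ᵣ-cong (*ᵣ-cong im≈ im≈′)))
    (+ᵣ-cong (*ᵣ-cong re≈ im≈′) (*ᵣ-cong im≈ re≈′))

  conj-cong : ∀ {z z′} → z ≈ z′ → conj z ≈ conj z′
  conj-cong (mk≈ re≈ im≈) = mk≈ re≈ (-ᵣ-cong im≈)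

  infix 5 _+⟨_⟩_

  -- The number p + iyr with rational p and r. With one fixed y, all terms of the autocorrelation
  -- have this form, so their sum reduces to two sums of rationals.
  _+⟨_⟩_ : ℚ → ℝ → ℚ → ℂ
  p +⟨ y ⟩ r = fromℚᵣ p +i (y *ᵣ fromℚᵣ r)

  sum-+⟨⟩ : ∀ {n} y {z : Fin n → ℂ} {p r : Fin n → ℚ} →
    (∀ i → z i ≈ (p i +⟨ y ⟩ r i)) → sum z ≈ (ℚΣ.sum p +⟨ y ⟩ ℚΣ.sum r)
  sum-+⟨⟩ {zero} y h = mk≈ (≈ᵣ-pointwise λ _ → refl) (≈ᵣ-pointwise λ k → sym (ℚ.*-zeroʳ (seq y k)))
  sum-+⟨⟩ {suc n} y {p = p} {r} h = ≈-trans
    (+-cong (h zero) (sum-+⟨⟩ y λ i → h (suc i)))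
    (mk≈ (≈ᵣ-pointwise λ _ → refl)
         (≈ᵣ-pointwise λ k → sym (ℚ.*-distribˡ-+ (seq y k) (r zero) (ℚΣ.sum (r ∘ suc)))))

  -- The product is uu′ + y²ww′ + iy(wu′ - uw′). The imaginary part agrees exactly; the real part is
  -- off by ww′(y² - 1), which is null.
  *-conj-+⟨⟩ : ∀ y → y *ᵣ y ≈ᵣ fromℚᵣ 1ℚ → ∀ {z z′ u u′ w w′} →
    z ≈ (u +⟨ y ⟩ w) → z′ ≈ (u′ +⟨ y ⟩ w′) →
    z * conj z′ ≈ (u ⊗ u′ ⊕ w ⊗ w′ +⟨ y ⟩ w ⊗ u′ ⊖ u ⊗ w′)
  *-conj-+⟨⟩ y (mk≈ᵣ y²-1) {u = u} {u′} {w} {w′} z≈ z′≈ =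
    ≈-trans (*-cong z≈ (conj-cong z′≈)) (mk≈
      (mk≈ᵣ (null-cong
        (λ k → solve 5 (λ y u u′ w w′ → (w :* w′) :* (y :* y :- con 1ℚ)
            := u :* u′ :- (y :* w) :* (:- (y :* w′)) :- (u :* u′ :+ w :* w′))
          refl (seq y k) u u′ w w′)
        (null-*ˡ (fromℚᵣ (w ⊗ w′)) y²-1)))
      (≈ᵣ-pointwise λ k → solve 5 (λ y u u′ w w′ → u :* (:- (y :* w′)) :+ (y :* w) :* u′
            := y :* (w :* u′ :- u :* w′)) refl (seq y k) u u′ w w′))

  imaginary^1 : ∀ {ζ} → re ζ ≈ᵣ fromℚᵣ 0ℚ → ζ ^ 1 ≈ (0ℚ +⟨ im ζ ⟩ 1ℚ)
  imaginary^1 {ζ} (mk≈ᵣ x≈0) = mk≈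
    (mk≈ᵣ (null-cong
      (λ k → solve 2 (λ x y → x :- con 0ℚ := x :* con 1ℚ :- y :* con 0ℚ :- con 0ℚ) refl
        (seq (re ζ) k) (seq (im ζ) k)) x≈0))
    (≈ᵣ-pointwise λ k → solve 2 (λ x y → x :* con 0ℚ :+ y :* con 1ℚ := y :* con 1ℚ) refl
      (seq (re ζ) k) (seq (im ζ) k))

  -- The product x(yΔ) is null, being a quarter of the imaginary part of ζ⁴. Neither Δ nor y is
  -- null, hence neither is yΔ, and cancelling it makes x null. Then y⁴ ≈ 1, which gives y² ≈ 1.
  primitive4 : ∀ {ζ} → IsPrimitiveRoot 4 ζ →
    (re ζ ≈ᵣ fromℚᵣ 0ℚ) × (im ζ *ᵣ im ζ ≈ᵣ fromℚᵣ 1ℚ)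
  primitive4 {x +i y} (mk≈ (mk≈ᵣ re≈) (mk≈ᵣ im≈) , minimal) =
    mk≈ᵣ (null-cong (λ k → sym (ℚ.+-identityʳ (seq x k))) nx) , mk≈ᵣ ny
    where
    -- ζ² = Δ + 2xyi, so the imaginary part of ζ⁴ is 4xyΔ.
    Δ yΔ 2x² : ℝ
    Δ = x *ᵣ x -ᵣ y *ᵣ y
    yΔ = y *ᵣ Δ
    2x² = x *ᵣ x +ᵣ x *ᵣ x

    ¼ℚ 4ℚ 6ℚ : ℚ
    ¼ℚ = ½ ⊗ ½
    4ℚ = (1ℚ ⊕ 1ℚ) ⊗ (1ℚ ⊕ 1ℚ)
    6ℚ = 4ℚ ⊕ (1ℚ ⊕ 1ℚ)

    re⁴ : ∀ k → seq (re ((x +i y) ^ 4)) k ≡ seq (Δ *ᵣ Δ) k ⊖ 4ℚ ⊗ seq (x *ᵣ x *ᵣ (y *ᵣ y)) k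
    re⁴ k = solve 2 (λ x y →
      -- `ζ ^ 1` unfolds to `ζ * 1#`, so the factors 1 and 0 remain visible.
      let re¹ = x :* con 1ℚ :- y :* con 0ℚ ; im¹ = x :* con 0ℚ :+ y :* con 1ℚ
          re² = x :* re¹ :- y :* im¹ ; im² = x :* im¹ :+ y :* re¹
          re³ = x :* re² :- y :* im² ; im³ = x :* im² :+ y :* re²
          d = x :* x :- y :* y
      in x :* re³ :- y :* im³ := d :* d :- con 4ℚ :* (x :* x :* (y :* y))) refl (seq x k) (seq y k)

    im⁴ : ∀ k → seq (im ((x +i y) ^ 4)) k ≡ 4ℚ ⊗ (seq x k ⊗ seq yΔ k)
    im⁴ k = solve 2 (λ x y →
      let re¹ = x :* con 1ℚ :- y :* con 0ℚ ; im¹ = x :* con 0ℚ :+ y :* con 1ℚ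
          re² = x :* re¹ :- y :* im¹ ; im² = x :* im¹ :+ y :* re¹
          re³ = x :* re² :- y :* im² ; im³ = x :* im² :+ y :* re²
          d = x :* x :- y :* y
      in x :* im³ :+ y :* re³ := con 4ℚ :* (x :* (y :* d))) refl (seq x k) (seq y k)

    x·yΔ-null : IsNull (λ k → seq x k ⊗ seq yΔ k)
    x·yΔ-null = null-cong
      (λ k → trans (cong (λ p → ¼ℚ ⊗ (p ⊖ 0ℚ)) (im⁴ k))
        (solve 1 (λ p → con ¼ℚ :* (con 4ℚ :* p :- con 0ℚ) := p) refl (seq x k ⊗ seq yΔ k)))
      (null-*ˡ (fromℚᵣ ¼ℚ) im≈)

    -- If x² ≈ y², then re ζ⁴ ≈ −(2x²)².
    ¬Δ-null : ¬ IsNull (seq Δ)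
    ¬Δ-null nΔ = ¬null-1+square (seq 2x²) (null-cong
      -- Substituting y² = x² - Δ gives re ζ⁴ = (Δ + 4x²)Δ - (2x²)², and the part divisible by Δ is
      -- null.
      (λ k → trans (cong (λ p → ⊖ (p ⊖ 1ℚ) ⊕ (seq Δ k ⊕ 4ℚ ⊗ seq (x *ᵣ x) k) ⊗ seq Δ k) (re⁴ k))
        (solve 2 (λ x y → let d = x :* x :- y :* y ; s = x :* x :+ x :* x in
          :- (d :* d :- con 4ℚ :* (x :* x :* (y :* y)) :- con 1ℚ) :+ (d :+ con 4ℚ :* (x :* x)) :* d
          := con 1ℚ :+ s :* s) refl (seq x k) (seq y k)))
      (null-+ (null-neg re≈)
        (null-*ˡ (Δ +ᵣ fromℚᵣ 4ℚ *ᵣ (x *ᵣ x)) nΔ)))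

    -- In u⁴ - 1 = (u² - 1)(1 + u²) the second factor is not null and can be cancelled.
    square-null : (u : ℝ) → IsNull (λ k → seq (u *ᵣ u *ᵣ (u *ᵣ u)) k ⊖ 1ℚ) →
      IsNull (λ k → seq (u *ᵣ u) k ⊖ 1ℚ)
    square-null u n = null-cancelʳ (u *ᵣ u -ᵣ fromℚᵣ 1ℚ)
      (null-cong (λ k → solve 1 (λ u → u :* u :* (u :* u) :- con 1ℚ
          := (u :* u :- con 1ℚ) :* (con 1ℚ :+ u :* u)) refl (seq u k)) n)
      (¬null-1+square (seq u))

    -- If one coordinate v of ζ is null, then re ζ⁴ ≈ u⁴ for the other one.
    other-null : (u v : ℝ) → IsNull (seq v) →
      (∀ k → seq (re ((x +i y) ^ 4)) k ≡ (seq u k ⊗ seq u k ⊖ seq v k ⊗ seq v k) ⊗ (seq u k ⊗ seq u k ⊖ seq v k ⊗ seq v k)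
          ⊖ 4ℚ ⊗ (seq u k ⊗ seq u k ⊗ (seq v k ⊗ seq v k))) →
      IsNull (λ k → seq (u *ᵣ u) k ⊖ 1ℚ)
    other-null u v nv eq = square-null u (null-cong
      -- As re ζ⁴ = u⁴ - 6u²v² + v⁴, adding the null term (6u²v - v³)v leaves u⁴.
      (λ k → trans (cong (λ p → p ⊖ 1ℚ ⊕ (6ℚ ⊗ seq (u *ᵣ u) k ⊗ seq v k ⊖ seq (v *ᵣ v *ᵣ v) k) ⊗ seq v k) (eq k))
        (solve 2 (λ u v → let d = u :* u :- v :* v in
          d :* d :- con 4ℚ :* (u :* u :* (v :* v)) :- con 1ℚ :+ (con 6ℚ :* (u :* u) :* v :- v :* v :* v) :* v
          := u :* u :* (u :* u) :- con 1ℚ) refl (seq u k) (seq v k)))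
      (null-+ re≈ (null-*ˡ (fromℚᵣ 6ℚ *ᵣ (u *ᵣ u) *ᵣ v -ᵣ v *ᵣ v *ᵣ v) nv)))

    -- If y were null, then x² ≈ 1 and so ζ² ≈ 1, against the minimality of the exponent 4.
    ¬y-null : ¬ IsNull (seq y)
    ¬y-null ny = minimal 2 (s≤s z≤n) (s≤s (s≤s (s≤s z≤n))) (mk≈
      (mk≈ᵣ (null-cong (λ k → solve 2 (λ x y →
        let re¹ = x :* con 1ℚ :- y :* con 0ℚ ; im¹ = x :* con 0ℚ :+ y :* con 1ℚ in
        x :* x :- con 1ℚ :+ (:- y) :* y := x :* re¹ :- y :* im¹ :- con 1ℚ) refl (seq x k) (seq y k))
        (null-+ (other-null x y ny re⁴) (null-*ˡ (-ᵣ y) ny))))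
      (mk≈ᵣ (null-cong (λ k → solve 2 (λ x y →
        let re¹ = x :* con 1ℚ :- y :* con 0ℚ ; im¹ = x :* con 0ℚ :+ y :* con 1ℚ in
        (x :+ x) :* y := x :* im¹ :+ y :* re¹ :- con 0ℚ) refl (seq x k) (seq y k))
        (null-*ˡ (x +ᵣ x) ny))))

    ¬yΔ-null : ¬ IsNull (seq yΔ)
    ¬yΔ-null n = ¬y-null (null-cancelʳ y n ¬Δ-null)

    nx : IsNull (seq x)
    nx = null-cancelʳ x x·yΔ-null ¬yΔ-null

    ny : IsNull (λ k → seq (y *ᵣ y) k ⊖ 1ℚ)
    -- re ζ⁴ is symmetric in x and y, so the roles can be exchanged.
    ny = other-null y x nx λ k → trans (re⁴ k) (solve 2 (λ x y →
      (x :* x :- y :* y) :* (x :* x :- y :* y) :- con 4ℚ :* (x :* x :* (y :* y))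
      := (y :* y :- x :* x) :* (y :* y :- x :* x) :- con 4ℚ :* (y :* y :* (x :* x))) refl (seq x k) (seq y k))

-- The values and the autocorrelation of the cyclotomic sequence.

module CyclotomicValues
  (f r : ℕ) (n≡4f : suc r ≡ 4 ℕ.* f) (q-prime : Prime (suc (suc r)))
  (g : Fin (suc (suc r))) (generator : IsGenerator (suc (suc r)) g)
  {ζ : ℂ} (isPrimitive : IsPrimitiveRoot 4 ζ)
  {a : ℕ → ℂ} (cyclotomic : IsCyclotomicSequence (suc (suc r)) f g ζ a) where

  open CharacterSums f r n≡4f q-prime g generator
  open ComplexArithmetic
  open IsCyclotomicSequence cyclotomic
  open NullSequences

  y : ℝ
  y = im ζ

  -- Reduce the exponent modulo `n` = 4f to `s`. The quotient of `s` by 4 is below `f` and indexes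
  -- the element within its class; the remainder names the class and fixes the parity.
  classify : ∀ (i : Fin q) e → toℕ i ∼ α ℕ.^ e → ∃[ k ] i ∈ 𝔇 q f g k × sign e ≡ sign (toℕ k)
  classify i e i∼α^e = byResidue (s ℕ.% 4) (m%n<n s 4) refl
    where
    s : ℕ
    s = e ℕ.% n
    s/4<f : s ℕ./ 4 ℕ.< f
    s/4<f = m<n*o⇒m/o<n (ℕ.<-≤-trans (m%n<n e n) (ℕ.≤-reflexive (trans n≡4f (ℕ.*-comm 4 f))))
    i≡ : ∀ k → s ℕ.% 4 ≡ k → i ≡ powMod q g (4 ℕ.* toℕ (fromℕ< s/4<f) ℕ.+ k)
    i≡ k eq = toℕ-injective (begin
      toℕ i                   ≡⟨ m<n⇒m%n≡m (toℕ<n i) ⟨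
      toℕ i ℕ.% q             ≡⟨ residues (∼-trans i∼α^e (α^-% n α^n∼1 e)) ⟩
      α ℕ.^ s ℕ.% q           ≡⟨ cong (λ d → α ℕ.^ d ℕ.% q) s≡ ⟩
      α ℕ.^ (4 ℕ.* toℕ (fromℕ< s/4<f) ℕ.+ k) ℕ.% q ≡⟨ toℕ-fromℕ< _ ⟨
      toℕ (powMod q g (4 ℕ.* toℕ (fromℕ< s/4<f) ℕ.+ k)) ∎)
      where
      open ≡-Reasoning
      s≡ : s ≡ 4 ℕ.* toℕ (fromℕ< s/4<f) ℕ.+ k
      s≡ = begin
        s                                ≡⟨ m≡m%n+[m/n]*n s 4 ⟩
        s ℕ.% 4 ℕ.+ s ℕ./ 4 ℕ.* 4        ≡⟨ cong₂ ℕ._+_ eq (ℕ.*-comm (s ℕ./ 4) 4) ⟩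
        k ℕ.+ 4 ℕ.* (s ℕ./ 4)            ≡⟨ ℕ.+-comm k (4 ℕ.* (s ℕ./ 4)) ⟩
        4 ℕ.* (s ℕ./ 4) ℕ.+ k            ≡⟨ cong (λ d → 4 ℕ.* d ℕ.+ k) (toℕ-fromℕ< s/4<f) ⟨
        4 ℕ.* toℕ (fromℕ< s/4<f) ℕ.+ k   ∎
    sign≡ : ∀ k → s ℕ.% 4 ≡ k → sign e ≡ sign k
    sign≡ k eq = begin
      sign e                                ≡⟨ sign-unique e s (α^-% n α^n∼1 e) ⟩
      sign s                                ≡⟨ cong sign (trans (m≡m%n+[m/n]*n s 4) (cong (ℕ._+ s ℕ./ 4 ℕ.* 4) eq)) ⟩
      sign (k ℕ.+ s ℕ./ 4 ℕ.* 4)            ≡⟨ cong (λ d → sign (k ℕ.+ d)) (double (s ℕ./ 4)) ⟩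
      sign (k ℕ.+ (s ℕ./ 4 ℕ.* 2 ℕ.+ s ℕ./ 4 ℕ.* 2)) ≡⟨ sign-+ k _ ⟩
      sign k ℚ.* sign (s ℕ./ 4 ℕ.* 2 ℕ.+ s ℕ./ 4 ℕ.* 2) ≡⟨ cong (sign k ℚ.*_) (sign-double (s ℕ./ 4 ℕ.* 2)) ⟩
      sign k ℚ.* 1ℚ                         ≡⟨ ℚ.*-identityʳ (sign k) ⟩
      sign k                                ∎
      where
      open ≡-Reasoning
      double : ∀ d → d ℕ.* 4 ≡ d ℕ.* 2 ℕ.+ d ℕ.* 2
      double = solve-∀
    byResidue : ∀ k → k ℕ.< 4 → s ℕ.% 4 ≡ k → ∃[ k′ ] i ∈ 𝔇 q f g k′ × sign e ≡ sign (toℕ k′)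
    byResidue 0 _ eq = 0F , inj₁ (fromℕ< s/4<f , i≡ 0 eq) , sign≡ 0 eq
    byResidue 1 _ eq = 1F , inj₁ (fromℕ< s/4<f , i≡ 1 eq) , sign≡ 1 eq
    -- `sign 2` and `sign 3` compute to `sign 0` and `sign 1`, as the union of the classes requires.
    byResidue 2 _ eq = 0F , inj₂ (fromℕ< s/4<f , i≡ 2 eq) , sign≡ 2 eq
    byResidue 3 _ eq = 1F , inj₂ (fromℕ< s/4<f , i≡ 3 eq) , sign≡ 3 eq
    byResidue (suc (suc (suc (suc _)))) (s≤s (s≤s (s≤s (s≤s ())))) _

  coordinate₀ coordinate₁ : Fin 2 → ℚ
  coordinate₀ 0F = 1ℚ
  coordinate₀ 1F = 0ℚ
  coordinate₁ 0F = 0ℚ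
  coordinate₁ 1F = 1ℚ

  coordinate₀≡ : ∀ k → ½ ℚ.* (1ℚ ℚ.+ sign (toℕ k)) ≡ coordinate₀ k
  coordinate₀≡ 0F = refl
  coordinate₀≡ 1F = refl

  coordinate₁≡ : ∀ k → ½ ℚ.* (1ℚ ℚ.- sign (toℕ k)) ≡ coordinate₁ k
  coordinate₁≡ 0F = refl
  coordinate₁≡ 1F = refl

  ζ^-+⟨⟩ : ∀ (k : Fin 2) → ζ ^ toℕ k ≈ (coordinate₀ k +⟨ y ⟩ coordinate₁ k)
  ζ^-+⟨⟩ 0F = mk≈ (≈ᵣ-pointwise λ _ → refl) (≈ᵣ-pointwise λ k → sym (ℚ.*-zeroʳ (seq y k)))
  ζ^-+⟨⟩ 1F = imaginary^1 (primitive4 isPrimitive .proj₁)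

  value : ∀ (i : Fin q) → a (toℕ i) ≈ (u (toℕ i) +⟨ y ⟩ w (toℕ i))
  value i = byView (residueView (toℕ i))
    where
    atZero′ : toℕ i ≡ 0 → a (toℕ i) ≈ (0ℚ +⟨ y ⟩ 0ℚ)
    atZero′ i≡0 = ≈-trans (subst (λ k → a k ≈ 0#) (sym i≡0) atZero)
      (mk≈ (≈ᵣ-pointwise λ _ → refl) (≈ᵣ-pointwise λ k → sym (ℚ.*-zeroʳ (seq y k))))
    byView : ResidueView (toℕ i) → a (toℕ i) ≈ (u (toℕ i) +⟨ y ⟩ w (toℕ i))
    byView (isZero i∼0) = subst₂ (λ p r → a (toℕ i) ≈ (p +⟨ y ⟩ r))
      (sym (u-zero i∼0)) (sym (w-zero i∼0)) (atZero′ (∼⇒≡ (toℕ<n i) (s≤s z≤n) i∼0))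
    byView (power e i∼α^e) = let k , i∈𝔇 , sign≡ = classify i e i∼α^e in
      subst₂ (λ p r → a (toℕ i) ≈ (p +⟨ y ⟩ r))
        (sym (trans (u-power e (toℕ k) i∼α^e sign≡) (coordinate₀≡ k)))
        (sym (trans (w-power e (toℕ k) i∼α^e sign≡) (coordinate₁≡ k)))
        (≈-trans (onClass k i i∈𝔇) (ζ^-+⟨⟩ k))

  -- The autocorrelation reduces its shifted index modulo `q`, while the character sums use i + t
  -- unreduced.
  value-% : ∀ i → a (i ℕ.% q) ≈ (u i +⟨ y ⟩ w i)
  value-% i = subst (λ z → a (i ℕ.% q) ≈ z)
    (cong₂ (_+⟨ y ⟩_) (u-cong (%-∼ i)) (w-cong (%-∼ i)))
    (subst (λ k → a k ≈ (u k +⟨ y ⟩ w k)) (toℕ-fromℕ< (m%n<n i q)) (value (i mod q)))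

  autocorrelation≈ : ∀ t → 1 ℕ.≤ t → t ℕ.< q →
    autocorrelation q a t ≈ fromℚ (½ ℚ.* (∑ (λ _ → 1ℚ) ℚ.- (1ℚ ℚ.+ 1ℚ ℚ.+ 1ℚ)))
  autocorrelation≈ t 1≤t t<q = ≈-trans
    (sum-+⟨⟩ y λ i → *-conj-+⟨⟩ y (primitive4 isPrimitive .proj₂) (value i) (value-% (toℕ i ℕ.+ t)))
    (mk≈ (≈ᵣ-pointwise λ _ → ∑-symmetric t≁0)
         (≈ᵣ-pointwise λ k → trans (cong (seq y k ℚ.*_) (∑-antisymmetric t)) (ℚ.*-zeroʳ (seq y k))))
    where
    t≁0 : ¬ (t ∼ 0)
    t≁0 t∼0 = ℕ.<⇒≢ 1≤t (sym (∼⇒≡ t<q (s≤s z≤n) t∼0))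

  almostMAry : IsAlmostMAry 4 1 q ζ a
  almostMAry = Subset.⁅ zero ⁆ , Subset.∣⁅x⁆∣≡1 {q} zero ,
    (λ i i∈Z → subst (λ j → a (toℕ j) ≈ 0#) (sym (Subset.x∈⁅y⁆⇒x≡y zero i∈Z)) atZero) ,
    λ i i∉Z →
      let e , i∼α^e = log (toℕ i) λ i∼0 →
            Subset.x∉⁅y⁆⇒x≢y i∉Z (toℕ-injective (∼⇒≡ (toℕ<n i) (s≤s z≤n) i∼0))
          k , i∈𝔇 , _ = classify i e i∼α^e
      -- The exponents 0 and 1 of the values are read as elements of `Fin 4`.
      in inject k , subst (λ d → a (toℕ i) ≈ ζ ^ d) (sym (toℕ-inject k)) (onClass k i i∈𝔇)
    where
    inject : Fin 2 → Fin 4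
    inject 0F = 0F
    inject 1F = 1F
    toℕ-inject : ∀ k → toℕ (inject k) ≡ toℕ k
    toℕ-inject 0F = refl
    toℕ-inject 1F = refl

-- Evaluation of the constant (q - 3)/2 and the theorem.

open import Data.Integer.Base using (+_)

-- In the unnormalised rationals the induction step becomes a cross-multiplied identity of integers.
sum-1 : ∀ k → ℚΣ.sum {k} (λ _ → 1ℚ) ≡ + k ℚ./ 1
sum-1 zero    = refl
sum-1 (suc k) = trans (cong (1ℚ ℚ.+_) (sum-1 k)) (ℚ.toℚᵘ-injective (begin
  ℚ.toℚᵘ (1ℚ ℚ.+ + k ℚ./ 1)            ≈⟨ ℚ.toℚᵘ-homo-+ 1ℚ (+ k ℚ./ 1) ⟩
  ℚ.toℚᵘ 1ℚ ℚᵘ.+ ℚ.toℚᵘ (+ k ℚ./ 1)    ≈⟨ ℚᵘ.+-congʳ (ℚ.toℚᵘ 1ℚ) (ℚ.toℚᵘ-fromℚᵘ (mkℚᵘ (+ k) 0)) ⟩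
  mkℚᵘ (+ 1) 0 ℚᵘ.+ mkℚᵘ (+ k) 0       ≈⟨ *≡* (identity (+ k)) ⟩
  mkℚᵘ (+ suc k) 0                     ≈⟨ ℚ.toℚᵘ-fromℚᵘ (mkℚᵘ (+ suc k) 0) ⟨
  ℚ.toℚᵘ (+ suc k ℚ./ 1)               ∎))
  where
  open SetoidReasoning ℚᵘ.≃-setoid
  identity : ∀ i → (+ 1 ℤ.* + 1 ℤ.+ i ℤ.* + 1) ℤ.* + 1 ≡ (+ 1 ℤ.+ i) ℤ.* + 1
  identity = ℤ.solve-∀

[i-3]/2 : ∀ i → ½ ℚ.* (i ℚ./ 1 ℚ.- (1ℚ ℚ.+ 1ℚ ℚ.+ 1ℚ)) ≡ (i ℤ.- + 3) ℚ./ 2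
[i-3]/2 i = ℚ.toℚᵘ-injective (begin
  ℚ.toℚᵘ (½ ℚ.* (i ℚ./ 1 ℚ.+ -3ℚ))            ≈⟨ ℚ.toℚᵘ-homo-* ½ (i ℚ./ 1 ℚ.+ -3ℚ) ⟩
  ℚ.toℚᵘ ½ ℚᵘ.* ℚ.toℚᵘ (i ℚ./ 1 ℚ.+ -3ℚ)      ≈⟨ ℚᵘ.*-congˡ {ℚ.toℚᵘ ½} (ℚ.toℚᵘ-homo-+ (i ℚ./ 1) -3ℚ) ⟩
  ℚ.toℚᵘ ½ ℚᵘ.* (ℚ.toℚᵘ (i ℚ./ 1) ℚᵘ.+ ℚ.toℚᵘ -3ℚ)
    ≈⟨ ℚᵘ.*-congˡ {ℚ.toℚᵘ ½} (ℚᵘ.+-congˡ (ℚ.toℚᵘ -3ℚ) (ℚ.toℚᵘ-fromℚᵘ (mkℚᵘ i 0))) ⟩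
  ℚ.toℚᵘ ½ ℚᵘ.* (mkℚᵘ i 0 ℚᵘ.+ ℚ.toℚᵘ -3ℚ)    ≈⟨ *≡* (identity i) ⟩
  mkℚᵘ (i ℤ.- + 3) 1                          ≈⟨ ℚ.toℚᵘ-fromℚᵘ (mkℚᵘ (i ℤ.- + 3) 1) ⟨
  ℚ.toℚᵘ ((i ℤ.- + 3) ℚ./ 2)                  ∎)
  where
  open SetoidReasoning ℚᵘ.≃-setoid
  -3ℚ : ℚ
  -3ℚ = ℚ.- (1ℚ ℚ.+ 1ℚ ℚ.+ 1ℚ)
  identity : ∀ i → (+ 1 ℤ.* (i ℤ.* + 1 ℤ.+ (ℤ.- + 3) ℤ.* + 1)) ℤ.* + 2 ≡ (i ℤ.- + 3) ℤ.* + 2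
  identity = ℤ.solve-∀

theorem4 : (q f : ℕ) .⦃ _ : NonZero q ⦄ → q ≡ 4 ℕ.* f ℕ.+ 1 → Prime q →
    (α : Fin q) → IsGenerator q α →
    (ζ₄ : ℂ) → IsPrimitiveRoot 4 ζ₄ →
    (a : ℕ → ℂ) → IsCyclotomicSequence q f α ζ₄ a →
    IsAlmostMAryNPS 4 1 q ζ₄ (fromℚ ((+ q ℤ.- + 3) ℚ./ 2)) a
theorem4 zero          f q≡ q-prime α generator ζ₄ isPrimitive a cyclotomic = contradiction (trans q≡ (ℕ.+-comm (4 ℕ.* f) 1)) λ ()
theorem4 (suc zero)    f q≡ q-prime α generator ζ₄ isPrimitive a cyclotomic = contradiction q-prime ¬prime[1]
theorem4 q@(suc (suc r)) f q≡ q-prime α generator ζ₄ isPrimitive a cyclotomic = record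
  { primitiveRoot = isPrimitive
  ; period        = IsCyclotomicSequence.period cyclotomic
  ; almostMAry    = almostMAry
  ; nearlyPerfect = λ t 1≤t t≤q-1 → subst (λ p → autocorrelation q a t ≈ fromℚ p)
      (trans (cong (λ p → ½ ℚ.* (p ℚ.- (1ℚ ℚ.+ 1ℚ ℚ.+ 1ℚ))) (sum-1 q)) ([i-3]/2 (+ q)))
      (autocorrelation≈ t 1≤t (s≤s t≤q-1))
  }
  where
  open CyclotomicValues f r (ℕ.suc-injective (trans q≡ (ℕ.+-comm (4 ℕ.* f) 1))) q-prime α generator isPrimitive cyclotomic
    using (almostMAry; autocorrelation≈)
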